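{- Let $T$ be an equilateral triangle. Then for every positive integer $n$, $$h(n,T)=\left\lfloor \frac{n}{3} \right\rfloor \cdot \left\lfloor \frac{n+1}{3} \right\rfloor \cdot \left\lfloor \frac{n+2}{3} \right\rfloor.$$
   Context: Let $T$ be a triangle with side lengths $a,b,c$, let $\varepsilon>0$ and $\varepsilon'=\varepsilon\cdot\min\{a,b,c\}$. A triangle $A'B'C'$ is $\varepsilon$-congruent to $T$ if there exist points $A,B,C\in\mathbb{R}^2$ such that $ABC$ is congruent to $T$ and $A',B',C'$ lie in the closed disks of radius $\varepsilon'$ around $A,B,C$ respectively. $h(n,T,\varepsilon)$ denotes the maximum, over all point sets $P\subseteq\mathbb{R}^2$ with $|P|=n$, of the number of 3-element subsets of $P$ forming a triangle $\varepsilon$-congruent to $T$, and $h(n,T):=\min_{\varepsilon>0}h(n,T,\varepsilon)$. -}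

module Defs where

open import Algebra.Bundles using (CommutativeRing)
import Algebra.Construct.NaturalChoice.Min as Min
open import Data.Fin.Base using (Fin)
open import Data.Fin.Subset using (Subset; ⁅_⁆; _∪_; ∣_∣)
open import Data.List.Base using (List; length)
open import Data.List.Membership.Propositional using (_∈_)
open import Data.List.Relation.Unary.Unique.Propositional using (Unique)
open import Data.Nat.Base as ℕ using (ℕ)
open import Data.Product.Base using (Σ; ∃; _×_; _,_)
open import Data.Product.Relation.Binary.Pointwise.NonDependent using (Pointwise)
open import Function.Bundles using (_⇔_)
open import Function.Definitions using (Injective)
open import Level using (0ℓ; suc)
open import Relation.Binary.Bundles using (TotalOrder)
open import Relation.Binary.Core using (Rel)
import Relation.Binary.Construct.NonStrictToStrict as NonStrictToStrict
open import Relation.Binary.PropositionalEquality.Core using (_≡_)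
open import Relation.Binary.Structures using (IsTotalOrder)
open import Relation.Nullary.Negation.Core using (¬_)
open import Relation.Unary using (Pred)

-- The real numbers, given by their axioms as a Dedekind-complete ordered
-- field.  Classically such a field is unique up to unique isomorphism, so a
-- statement about an arbitrary RealField (under excluded middle) is a
-- statement about ℝ.  Equality of reals is the ring's setoid equality _≈_.
record RealField : Set (suc 0ℓ) where
  field
    commutativeRing : CommutativeRing 0ℓ 0ℓ

  open CommutativeRing commutativeRing public

  infix 4 _≤_

  field
    0≉1          : ¬ (0# ≈ 1#)
    inverse      : ∀ x → ¬ (x ≈ 0#) → ∃ λ y → x * y ≈ 1#
    _≤_          : Rel Carrier 0ℓ
    isTotalOrder : IsTotalOrder _≈_ _≤_
    +-monoˡ-≤    : ∀ z {x y} → x ≤ y → x + z ≤ y + z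
    *-nonNeg     : ∀ {x y} → 0# ≤ x → 0# ≤ y → 0# ≤ x * y

  UpperBound : Pred Carrier 0ℓ → Pred Carrier 0ℓ
  UpperBound S u = ∀ x → S x → x ≤ u

  field
    supremum : ∀ (S : Pred Carrier 0ℓ) → ∃ S → ∃ (UpperBound S) →
               ∃ λ s → UpperBound S s × (∀ u → UpperBound S u → s ≤ u)

  totalOrder : TotalOrder 0ℓ 0ℓ 0ℓ
  totalOrder = record { isTotalOrder = isTotalOrder }

  open NonStrictToStrict _≈_ _≤_ public using (_<_)
  open Min totalOrder public using (_⊓_)

IsMaximum : ∀ {ℓ} → Pred ℕ ℓ → Pred ℕ ℓ
IsMaximum S m = S m × (∀ k → S k → k ℕ.≤ m)

IsMinimum : ∀ {ℓ} → Pred ℕ ℓ → Pred ℕ ℓ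
IsMinimum S m = S m × (∀ k → S k → m ℕ.≤ k)

-- HasCard Q k: exactly k elements satisfy Q.  It is a relation because Q need
-- not be decidable.
HasCard : ∀ {A : Set} → Pred A 0ℓ → Pred ℕ 0ℓ
HasCard {A} Q k =
  Σ (List A) λ xs → Unique xs × length xs ≡ k × (∀ x → x ∈ xs ⇔ Q x)

module Plane (ℝ : RealField) where
  open RealField ℝ

  Point : Set
  Point = Carrier × Carrier

  infix 4 _≈ₚ_

  _≈ₚ_ : Rel Point 0ℓ
  _≈ₚ_ = Pointwise _≈_ _≈_

  -- IsDist A B d: d is the Euclidean distance √((x_A - x_B)² + (y_A - y_B)²).
  IsDist : Point → Point → Carrier → Set
  IsDist (x₁ , y₁) (x₂ , y₂) d =
    0# ≤ d × d * d ≈ (x₁ - x₂) * (x₁ - x₂) + (y₁ - y₂) * (y₁ - y₂)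

  InClosedDisk : Point → Carrier → Point → Set
  InClosedDisk centre radius X = ∃ λ d → IsDist centre X d × d ≤ radius

  Collinear : Point → Point → Point → Set
  Collinear (x₁ , y₁) (x₂ , y₂) (x₃ , y₃) =
    (x₂ - x₁) * (y₃ - y₁) ≈ (y₂ - y₁) * (x₃ - x₁)

  record Triangle : Set where
    field
      A B C        : Point
      nonCollinear : ¬ Collinear A B C
      a b c        : Carrier
      |BC|≡a       : IsDist B C a
      |CA|≡b       : IsDist C A b
      |AB|≡c       : IsDist A B c

  IsEquilateral : Triangle → Set
  IsEquilateral T = a ≈ b × b ≈ c
    where open Triangle T

  -- Congruence with vertices in corresponding order; the freedom to relabel
  -- enters in FormsTriangle.
  Congruent : Point → Point → Point → Triangle → Set
  Congruent A B C T =
    IsDist B C (Triangle.a T) × IsDist C A (Triangle.b T) × IsDist A B (Triangle.c T)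

  tolerance : Triangle → Carrier → Carrier
  tolerance T ε = ε * (a ⊓ b ⊓ c)
    where open Triangle T

  record EpsCongruent (T : Triangle) (ε : Carrier) (A′ B′ C′ : Point) : Set where
    field
      isTriangle : ¬ Collinear A′ B′ C′
      A B C      : Point
      congruent  : Congruent A B C T
      A-close    : InClosedDisk A (tolerance T ε) A′
      B-close    : InClosedDisk B (tolerance T ε) B′
      C-close    : InClosedDisk C (tolerance T ε) C′

  -- An n-element point set, listed without repetition.
  PointSet : ℕ → Set
  PointSet n = Σ (Fin n → Point) (Injective _≡_ _≈ₚ_)

  -- The 3-element subset of P with index set S is, under some labelling of
  -- its points as A′, B′, C′, ε-congruent to T.
  FormsTriangle : ∀ {n} → Triangle → Carrier → PointSet n → Pred (Subset n) 0ℓ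
  FormsTriangle T ε (p , _) S =
    ∣ S ∣ ≡ 3 ×
    ∃ λ i → ∃ λ j → ∃ λ k →
      S ≡ ⁅ i ⁆ ∪ ⁅ j ⁆ ∪ ⁅ k ⁆ × EpsCongruent T ε (p i) (p j) (p k)

  -- m is h(n, T, ε).
  Is-hε : ℕ → Triangle → Carrier → Pred ℕ 0ℓ
  Is-hε n T ε = IsMaximum λ k → ∃ λ (P : PointSet n) → HasCard (FormsTriangle T ε P) k

  -- m is h(n, T), the minimum of h(n, T, ε) over ε > 0.
  Is-h : ℕ → Triangle → Pred ℕ 0ℓ
  Is-h n T = IsMinimum λ m → ∃ λ ε → 0# < ε × Is-hε n T ε m

{-# OPTIONS --safe #-}

-- For ε = 1/50 the vertices of a triangle ε-congruent to the equilateral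
-- triangle T of side s are pairwise at distance close to s.  In the graph
-- joining points at such distances there is no K₄: three vectors in the plane
-- are linearly dependent, so their Gram matrix is singular, whereas four points
-- pairwise at distance about s would give a Gram matrix close to s²/2 (I + J),
-- which is positive definite.  Zykov's theorem bounds the triangles of a
-- K₄-free graph by those of the balanced complete tripartite graph.
-- Conversely, for every ε three balanced clusters of points near the vertices
-- of T attain this number.
module Submission where

open import Defs
open import Algebra.Bundles using (CommutativeRing)
import Algebra.Construct.NaturalChoice.Min as Min
import Algebra.Properties.Ring
import Algebra.Properties.Semiring.Mult
import Algebra.Solver.Ring
open import Algebra.Solver.Ring.AlmostCommutativeRing
  using (_-Raw-AlmostCommutative⟶_; fromCommutativeRing)
open import Axiom.ExcludedMiddle using (ExcludedMiddle)
open import Data.Bool.Base using (Bool; true; false; if_then_else_; _∧_)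
open import Data.Bool.Properties using (∧-zeroʳ)
open import Data.Empty using (⊥; ⊥-elim)
open import Data.Fin.Base as Fin using (Fin; zero; suc; toℕ; splitAt; _↑ˡ_; _↑ʳ_; remQuot; combine)
open import Data.Fin.Patterns using (0F; 1F; 2F)
import Data.Fin.Properties as Fin
open import Data.Fin.Subset using (Subset; inside; outside; ⁅_⁆; _∪_; ∣_∣; _∉_)
  renaming (_∈_ to _∈ₛ_)
open import Data.Fin.Subset.Properties
  using (∪-assoc; ∪-comm; ∪-identityˡ; x∈p∪q⁻; x∈p∪q⁺; x∈⁅x⁆; x∈⁅y⁆⇒x≡y; x≢y⇒x∉⁅y⁆; ∣⁅x⁆∣≡1)
open import Data.Integer.Base as ℤ using (ℤ; +_; -[1+_])
import Data.Integer.Properties as ℤ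
open import Data.List.Base
  using (List; []; _∷_; [_]; _++_; length; map; filter; lookup; replicate; allFin)
open import Data.List.Membership.Propositional using (_∈_)
open import Data.List.Membership.Propositional.Properties
  using (∈-++⁺ˡ; ∈-++⁺ʳ; ∈-map⁺; ∈-map⁻; ∈-filter⁺; ∈-filter⁻; ∈-allFin; ∈-lookup)
import Data.List.Properties as List
open import Data.List.Relation.Binary.Permutation.Propositional.Properties
  using (↭-length; shift) renaming (map⁺ to ↭-map⁺)
open import Data.List.Relation.Unary.All as All using ([])
open import Data.List.Relation.Unary.AllPairs using ([]; _∷_)
open import Data.List.Relation.Unary.Any using (here; there; index)
open import Data.List.Relation.Unary.Any.Properties using (lookup-index)
open import Data.List.Relation.Unary.Unique.Propositional using (Unique)
import Data.List.Relation.Unary.Unique.Propositional.Properties as Unique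
open import Data.Maybe.Base as Maybe using ()
open import Data.Nat.Base as ℕ using (ℕ; zero; suc)
import Data.Nat.Properties as ℕ
open import Data.Product.Base using (∃; _×_; _,_; proj₁; proj₂)
import Data.Sign.Base as Sign
open import Data.Sum.Base using (_⊎_; inj₁; inj₂; [_,_]′)
open import Data.Vec.Base as Vec using ([]; _∷_)
open import Data.Vec.Properties using (∷-injectiveʳ; ∷-injectiveˡ)
open import Function.Base using (_∘_; const)
open import Function.Bundles using (mk⇔; Equivalence)
open import Level using (0ℓ)
open import Relation.Binary.PropositionalEquality.Core as ≡ using (_≡_; _≢_)
import Relation.Binary.Reasoning.Setoid
open import Relation.Binary.Structures using (IsTotalOrder)
open import Relation.Nullary using (¬_; Dec; yes; no; does)
open import Relation.Nullary.Decidable using (dec⇒maybe; dec-true; does-⇔)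
open import Relation.Nullary.Negation using (contradiction)
open import Relation.Unary using (Pred)

-- The field is abstract, so every estimate is given by a certificate: the difference of the two
-- sides is written as a sum of products of nonnegative terms, and a ring solver checks the
-- identity. Distances therefore enter squared and rational constants are cleared to integers. The
-- tolerance 1/50 keeps squared distances within a tenth of s². With that margin two certificates
-- still close: the one bounding cross products away from zero and the one for definiteness of the
-- Gram form. Zykov's induction has to bound edges together with triangles: after a triangle is
-- deleted, the lost triangles having just one vertex in it are counted by the edges among the
-- remaining vertices. The upper bound at ε = 1/50 and the lower bound at every ε are the same
-- number, so the minimum over ε is attained at 1/50 and no limit is taken.

-- Integer coefficients for the ring solver.

module IntegerSolver (R : CommutativeRing 0ℓ 0ℓ) where
  open CommutativeRing R
  open Algebra.Properties.Ring ring
    using (-0#≈0#; -‿involutive; -‿+-comm; -‿distribˡ-*; -‿distribʳ-*)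
  open Algebra.Properties.Semiring.Mult semiring
    using (×-homo-+; ×1-homo-*) renaming (_×_ to _·_)
  open Relation.Binary.Reasoning.Setoid setoid

  -- The canonical homomorphism from ℤ. Coefficients taken in ℤ have decidable equality, which the
  -- solver can use when it collects terms.
  ι : ℤ → Carrier
  ι (+ n)    = n · 1#
  ι -[1+ n ] = - (suc n · 1#)

  private
    ι-neg : ∀ i → ι (ℤ.- i) ≈ - ι i
    ι-neg (+ zero)  = sym -0#≈0#
    ι-neg (+ suc n) = refl
    ι-neg -[1+ n ]  = sym (-‿involutive _)

    ι-⊖ : ∀ m n → ι (m ℤ.⊖ n) ≈ m · 1# - n · 1#
    ι-⊖ m zero = begin
      m · 1#             ≈⟨ +-identityʳ _ ⟨
      m · 1# + 0#        ≈⟨ +-congˡ -0#≈0# ⟨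
      m · 1# - 0#        ∎
    ι-⊖ zero (suc n) = sym (+-identityˡ _)
    ι-⊖ (suc m) (suc n) = begin
      ι (suc m ℤ.⊖ suc n)                    ≡⟨ ≡.cong ι (ℤ.[1+m]⊖[1+n]≡m⊖n m n) ⟩
      ι (m ℤ.⊖ n)                            ≈⟨ ι-⊖ m n ⟩
      m · 1# - n · 1#                        ≈⟨ +-congʳ (+-identityˡ _) ⟨
      (0# + m · 1#) - n · 1#                 ≈⟨ +-congʳ (+-congʳ (-‿inverseʳ 1#)) ⟨
      (1# - 1# + m · 1#) - n · 1#            ≈⟨ +-congʳ (+-assoc _ _ _) ⟩
      (1# + (- 1# + m · 1#)) - n · 1#        ≈⟨ +-congʳ (+-congˡ (+-comm _ _)) ⟩
      (1# + (m · 1# - 1#)) - n · 1#          ≈⟨ +-congʳ (+-assoc _ _ _) ⟨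
      ((1# + m · 1#) - 1#) - n · 1#          ≈⟨ +-assoc _ _ _ ⟩
      (1# + m · 1#) + (- 1# - n · 1#)        ≈⟨ +-congˡ (-‿+-comm _ _) ⟩
      (1# + m · 1#) - (1# + n · 1#)          ∎

    ι-+ : ∀ i j → ι (i ℤ.+ j) ≈ ι i + ι j
    ι-+ (+ m)    (+ n)    = ×-homo-+ 1# m n
    ι-+ (+ m)    -[1+ n ] = ι-⊖ m (suc n)
    ι-+ -[1+ m ] (+ n)    = trans (ι-⊖ n (suc m)) (+-comm _ _)
    ι-+ -[1+ m ] -[1+ n ] = begin
      - (suc (suc (m ℕ.+ n)) · 1#)            ≡⟨ ≡.cong (λ k → - (suc k · 1#)) (ℕ.+-suc m n) ⟨
      - ((suc m ℕ.+ suc n) · 1#)              ≈⟨ -‿cong (×-homo-+ 1# (suc m) (suc n)) ⟩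
      - (suc m · 1# + suc n · 1#)             ≈⟨ -‿+-comm _ _ ⟨
      - (suc m · 1#) - (suc n · 1#)           ∎

    ι-+◃ : ∀ n → ι (Sign.+ ℤ.◃ n) ≈ n · 1#
    ι-+◃ n = reflexive (≡.cong ι (ℤ.+◃n≡+n n))

    ι--◃ : ∀ n → ι (Sign.- ℤ.◃ n) ≈ - (n · 1#)
    ι--◃ n = trans (reflexive (≡.cong ι (ℤ.-◃n≡-n n))) (ι-neg (+ n))

    ι-* : ∀ i j → ι (i ℤ.* j) ≈ ι i * ι j
    ι-* (+ m) (+ n) = trans (ι-+◃ (m ℕ.* n)) (×1-homo-* m n)
    ι-* (+ m) -[1+ n ] = begin
      ι (Sign.- ℤ.◃ (m ℕ.* suc n))     ≈⟨ ι--◃ (m ℕ.* suc n) ⟩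
      - ((m ℕ.* suc n) · 1#)           ≈⟨ -‿cong (×1-homo-* m (suc n)) ⟩
      - (m · 1# * (suc n · 1#))        ≈⟨ -‿distribʳ-* _ _ ⟩
      m · 1# * (- (suc n · 1#))        ∎
    ι-* -[1+ m ] (+ n) = begin
      ι (Sign.- ℤ.◃ (suc m ℕ.* n))     ≈⟨ ι--◃ (suc m ℕ.* n) ⟩
      - ((suc m ℕ.* n) · 1#)           ≈⟨ -‿cong (×1-homo-* (suc m) n) ⟩
      - (suc m · 1# * (n · 1#))        ≈⟨ -‿distribˡ-* _ _ ⟩
      (- (suc m · 1#)) * (n · 1#)      ∎
    ι-* -[1+ m ] -[1+ n ] = begin
      ι (Sign.+ ℤ.◃ (suc m ℕ.* suc n))           ≈⟨ ι-+◃ (suc m ℕ.* suc n) ⟩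
      (suc m ℕ.* suc n) · 1#                     ≈⟨ ×1-homo-* (suc m) (suc n) ⟩
      suc m · 1# * (suc n · 1#)                  ≈⟨ -‿involutive _ ⟨
      - (- (suc m · 1# * (suc n · 1#)))          ≈⟨ -‿cong (-‿distribˡ-* _ _) ⟩
      - ((- (suc m · 1#)) * (suc n · 1#))        ≈⟨ -‿distribʳ-* _ _ ⟩
      (- (suc m · 1#)) * (- (suc n · 1#))        ∎

    ι-homo : ℤ.+-*-rawRing -Raw-AlmostCommutative⟶ fromCommutativeRing R
    ι-homo = record
      { ⟦_⟧    = ι
      ; +-homo = ι-+
      ; *-homo = ι-*
      ; -‿homo = ι-neg
      ; 0-homo = refl
      ; 1-homo = +-identityʳ 1#
      }

  open Algebra.Solver.Ring ℤ.+-*-rawRing (fromCommutativeRing R) ι-homo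
    (λ i j → Maybe.map (λ i≡j → reflexive (≡.cong ι i≡j)) (dec⇒maybe (i ℤ.≟ j)))
    public using (solve; con; _:=_; _:+_; _:*_; _:-_)

-- Order and positivity in the real field.

module OrderedField (em : ExcludedMiddle 0ℓ) (ℝ : RealField) where
  open RealField ℝ
  open IntegerSolver commutativeRing public
  open IsTotalOrder isTotalOrder public
    using (antisym; total)
    renaming (refl to ≤-refl; trans to ≤-trans; reflexive to ≤-reflexive)

  # : ℕ → Carrier
  # n = ι (+ n)

  ≤-respʳ : ∀ {x y z} → x ≤ y → y ≈ z → x ≤ z
  ≤-respʳ x≤y y≈z = ≤-trans x≤y (≤-reflexive y≈z)

  ≤-respˡ : ∀ {x y z} → x ≈ y → y ≤ z → x ≤ z
  ≤-respˡ x≈y y≤z = ≤-trans (≤-reflexive x≈y) y≤z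

  x≤y⇒0≤y-x : ∀ {x y} → x ≤ y → 0# ≤ y - x
  x≤y⇒0≤y-x {x} x≤y = ≤-respˡ (sym (-‿inverseʳ x)) (+-monoˡ-≤ (- x) x≤y)

  0≤y-x⇒x≤y : ∀ {x y} → 0# ≤ y - x → x ≤ y
  0≤y-x⇒x≤y {x} {y} p = ≤-respʳ (≤-respˡ (sym (+-identityˡ x)) (+-monoˡ-≤ x p))
    (solve 2 (λ x y → y :- x :+ x := y) refl x y)

  +-nonNeg : ∀ {x y} → 0# ≤ x → 0# ≤ y → 0# ≤ x + y
  +-nonNeg {x} {y} 0≤x 0≤y =
    ≤-trans 0≤y (≤-respˡ (sym (+-identityˡ y)) (+-monoˡ-≤ y 0≤x))

  sq-nonNeg : ∀ x → 0# ≤ x * x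
  sq-nonNeg x with total 0# x
  ... | inj₁ 0≤x = *-nonNeg 0≤x 0≤x
  ... | inj₂ x≤0 = ≤-respʳ (*-nonNeg (x≤y⇒0≤y-x x≤0) (x≤y⇒0≤y-x x≤0))
    (solve 1 (λ x → (con (+ 0) :- x) :* (con (+ 0) :- x) := x :* x) refl x)

  #-nonNeg : ∀ n → 0# ≤ # n
  #-nonNeg zero    = ≤-refl
  #-nonNeg (suc n) = +-nonNeg 0≤1 (#-nonNeg n)
    where 0≤1 = ≤-respʳ (sq-nonNeg 1#) (*-identityˡ 1#)

  *-cancelʳ-≈0 : ∀ {x y} → ¬ (y ≈ 0#) → x * y ≈ 0# → x ≈ 0#
  *-cancelʳ-≈0 {x} {y} y≉0 xy≈0 with inverse y y≉0
  ... | z , yz≈1 = trans (sym (*-identityʳ x)) (trans (*-congˡ (sym yz≈1))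
        (trans (sym (*-assoc x y z)) (trans (*-congʳ xy≈0) (zeroˡ z))))

  -- By totality this amounts to `0# < x`, but in negated form it passes along `_≤_` by mere
  -- composition.
  Positive : Carrier → Set
  Positive x = ¬ (x ≤ 0#)

  positive⇒nonNeg : ∀ {x} → Positive x → 0# ≤ x
  positive⇒nonNeg {x} x>0 with total 0# x
  ... | inj₁ 0≤x = 0≤x
  ... | inj₂ x≤0 = contradiction x≤0 x>0

  positive⇒≉0 : ∀ {x} → Positive x → ¬ (x ≈ 0#)
  positive⇒≉0 x>0 x≈0 = x>0 (≤-reflexive x≈0)

  ≉0⇒positive : ∀ {x} → 0# ≤ x → ¬ (x ≈ 0#) → Positive x
  ≉0⇒positive 0≤x x≉0 x≤0 = x≉0 (antisym x≤0 0≤x)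

  positive-≤ : ∀ {x y} → Positive x → x ≤ y → Positive y
  positive-≤ x>0 x≤y y≤0 = x>0 (≤-trans x≤y y≤0)

  positive-≈ : ∀ {x y} → Positive x → x ≈ y → Positive y
  positive-≈ x>0 x≈y = positive-≤ x>0 (≤-reflexive x≈y)

  *-positive : ∀ {x y} → Positive x → Positive y → Positive (x * y)
  *-positive x>0 y>0 =
    ≉0⇒positive (*-nonNeg (positive⇒nonNeg x>0) (positive⇒nonNeg y>0))
      λ xy≈0 → positive⇒≉0 x>0 (*-cancelʳ-≈0 (positive⇒≉0 y>0) xy≈0)

  *-cancelˡ-positive : ∀ {x y} → 0# ≤ x → Positive (x * y) → Positive y
  *-cancelˡ-positive {x} {y} 0≤x xy>0 y≤0 = xy>0 (0≤y-x⇒x≤y (≤-respʳ (*-nonNeg 0≤x (x≤y⇒0≤y-x y≤0))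
    (solve 2 (λ x y → x :* (con (+ 0) :- y) := con (+ 0) :- x :* y) refl x y)))

  1-positive : Positive 1#
  1-positive = ≉0⇒positive (≤-respʳ (sq-nonNeg 1#) (*-identityˡ 1#)) λ 1≈0 → 0≉1 (sym 1≈0)

  #-positive : ∀ n → Positive (# (suc n))
  #-positive n = positive-≤ 1-positive
    (0≤y-x⇒x≤y (≤-respʳ (#-nonNeg n) (solve 2 (λ x y → y := x :+ y :- x) refl 1# (# n))))

  -- Indexed by the predecessor: the number inverted is n + 1, so 1/2 and 1/50 are obtained at 1 and
  -- 49.
  reciprocal : ∀ n → ∃ λ x → Positive x × # (suc n) * x ≈ 1#
  reciprocal n with inverse (# (suc n)) (positive⇒≉0 (#-positive n))
  ... | x , nx≈1 =
    x , *-cancelˡ-positive (#-nonNeg (suc n)) (positive-≈ 1-positive (sym nx≈1)) , nx≈1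

  sq≤0⇒≈0 : ∀ {x} → x * x ≤ 0# → x ≈ 0#
  sq≤0⇒≈0 {x} xx≤0 with em {P = x ≈ 0#}
  ... | yes x≈0 = x≈0
  ... | no x≉0  = *-cancelʳ-≈0 x≉0 (antisym xx≤0 (sq-nonNeg x))

  sq-mono-≤ : ∀ {x y} → 0# ≤ x → x ≤ y → x * x ≤ y * y
  sq-mono-≤ {x} {y} 0≤x x≤y =
    0≤y-x⇒x≤y (≤-respʳ (*-nonNeg (x≤y⇒0≤y-x x≤y) (+-nonNeg (≤-trans 0≤x x≤y) 0≤x))
      (solve 2 (λ x y → (y :- x) :* (y :+ x) := y :* y :- x :* x) refl x y))

  *-monoʳ-≤ : ∀ {x y z} → 0# ≤ z → x ≤ y → z * x ≤ z * y
  *-monoʳ-≤ {x} {y} {z} 0≤z x≤y = 0≤y-x⇒x≤y (≤-respʳ (*-nonNeg 0≤z (x≤y⇒0≤y-x x≤y))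
    (solve 3 (λ x y z → z :* (y :- x) := z :* y :- z :* x) refl x y z))

  common-lower : ∀ {x y} → Positive x → Positive y → ∃ λ r → Positive r × r ≤ x × r ≤ y
  common-lower {x} {y} x>0 y>0 with total x y
  ... | inj₁ x≤y = x , x>0 , ≤-refl , x≤y
  ... | inj₂ y≤x = y , y>0 , y≤x , ≤-refl

-- Geometry of points at nearly equal distances.

module NearUnitGraph (em : ExcludedMiddle 0ℓ) (ℝ : RealField) where
  open RealField ℝ
  open Plane ℝ
  open OrderedField em ℝ

  dist² : Point → Point → Carrier
  dist² (x₁ , y₁) (x₂ , y₂) = (x₁ - x₂) * (x₁ - x₂) + (y₁ - y₂) * (y₁ - y₂)

  norm² : Point → Carrier
  norm² (x , y) = x * x + y * y

  infixl 6 _⊖_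
  _⊖_ : Point → Point → Point
  (x₁ , y₁) ⊖ (x₂ , y₂) = x₁ - x₂ , y₁ - y₂

  cross : Point → Point → Carrier
  cross (x₁ , y₁) (x₂ , y₂) = x₁ * y₂ - y₁ * x₂

  -- The window from 9/10 to 11/10 of σ, with denominators cleared. `D` is a squared distance, and σ
  -- will be the squared side of the triangle.
  Near : Carrier → Carrier → Set
  Near σ D = # 18 * σ ≤ # 20 * D × # 20 * D ≤ # 22 * σ

  Near-resp : ∀ {σ D E} → D ≈ E → Near σ D → Near σ E
  Near-resp D≈E (l , u) = ≤-respʳ l (*-congˡ D≈E) , ≤-respˡ (*-congˡ (sym D≈E)) u

  Near-positive : ∀ {σ D} → Positive σ → Near σ D → Positive D
  Near-positive {σ} {D} σ>0 (l , _) =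
    *-cancelˡ-positive (#-nonNeg 20) (positive-≤ (*-positive (#-positive 17) σ>0) l)

  Adj : Carrier → Point → Point → Set
  Adj σ P Q = Near σ (dist² P Q)

  dist²-sym : ∀ P Q → dist² P Q ≈ dist² Q P
  dist²-sym (x₁ , y₁) (x₂ , y₂) = solve 4 (λ x₁ y₁ x₂ y₂ →
    (x₁ :- x₂) :* (x₁ :- x₂) :+ (y₁ :- y₂) :* (y₁ :- y₂) :=
    (x₂ :- x₁) :* (x₂ :- x₁) :+ (y₂ :- y₁) :* (y₂ :- y₁)) refl x₁ y₁ x₂ y₂

  dist²-⊖ : ∀ O P Q → dist² P Q ≈ dist² (P ⊖ O) (Q ⊖ O)
  dist²-⊖ (x₀ , y₀) (x₁ , y₁) (x₂ , y₂) = +-cong (sq x₀ x₁ x₂) (sq y₀ y₁ y₂)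
    where
    sq : ∀ a b c → (b - c) * (b - c) ≈ ((b - a) - (c - a)) * ((b - a) - (c - a))
    sq = solve 3 (λ a b c → (b :- c) :* (b :- c) :=
      ((b :- a) :- (c :- a)) :* ((b :- a) :- (c :- a))) refl

  dist²≈0 : ∀ {P Q} → P ≈ₚ Q → dist² P Q ≈ 0#
  dist²≈0 {x₁ , y₁} {x₂ , y₂} (x₁≈x₂ , y₁≈y₂) = trans
    (+-cong (*-cong (+-congʳ x₁≈x₂) (+-congʳ x₁≈x₂)) (*-cong (+-congʳ y₁≈y₂) (+-congʳ y₁≈y₂)))
    (solve 2 (λ x y → (x :- x) :* (x :- x) :+ (y :- y) :* (y :- y) := con (+ 0)) refl x₂ y₂)

  Adj-sym : ∀ {σ} P Q → Adj σ P Q → Adj σ Q P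
  Adj-sym P Q = Near-resp (dist²-sym P Q)

  Adj⇒≉ : ∀ {σ P Q} → Positive σ → Adj σ P Q → ¬ P ≈ₚ Q
  Adj⇒≉ σ>0 PQ P≈Q = positive⇒≉0 (Near-positive σ>0 PQ) (dist²≈0 P≈Q)

  -- 4 |p × q|² = 4 |p|² |q|² - (|p|² + |q|² - |p - q|²)²
  cross-bound : ∀ {σ} p q → 0# ≤ σ → Near σ (norm² p) → Near σ (norm² q) → Near σ (dist² p q) →
                # 620 * (σ * σ) ≤ # 1600 * (cross p q * cross p q)
  cross-bound {σ} (p₁ , p₂) (q₁ , q₂) 0≤σ (l₁ , u₁) (l₂ , u₂) (l₃ , u₃) =
    0≤y-x⇒x≤y (≤-respʳ (gap _ _ _ (x≤y⇒0≤y-x l₁) (x≤y⇒0≤y-x u₁) (x≤y⇒0≤y-x l₂)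
                         (x≤y⇒0≤y-x u₂) (x≤y⇒0≤y-x l₃) (x≤y⇒0≤y-x u₃))
      (solve 5 (λ σ p₁ p₂ q₁ q₂ →
        let X = con (+ 20) :* (p₁ :* p₁ :+ p₂ :* p₂)
            Y = con (+ 20) :* (q₁ :* q₁ :+ q₂ :* q₂)
            Z = con (+ 20) :* ((p₁ :- q₁) :* (p₁ :- q₁) :+ (p₂ :- q₂) :* (p₂ :- q₂))
            c = p₁ :* q₂ :- p₂ :* q₁
        in con (+ 4) :* (X :* Y) :- (X :+ Y :- Z) :* (X :+ Y :- Z) :- con (+ 620) :* (σ :* σ) :=
           con (+ 1600) :* (c :* c) :- con (+ 620) :* (σ :* σ)) refl σ p₁ p₂ q₁ q₂))
    where
    -- The constant is 4 · 18² - 26² = 620: each of X and Y is at least 18σ, and X + Y - Z is at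
    -- most (22 + 22 - 18)σ. The second product in the certificate is 26²σ² - (X + Y - Z)² factored
    -- as a difference of squares.
    gap : ∀ X Y Z →
      0# ≤ X - # 18 * σ → 0# ≤ # 22 * σ - X →
      0# ≤ Y - # 18 * σ → 0# ≤ # 22 * σ - Y →
      0# ≤ Z - # 18 * σ → 0# ≤ # 22 * σ - Z →
      0# ≤ # 4 * (X * Y) - (X + Y - Z) * (X + Y - Z) - # 620 * (σ * σ)
    gap X Y Z l₁ u₁ l₂ u₂ l₃ u₃ = ≤-respʳ
      (+-nonNeg
        (*-nonNeg (#-nonNeg 4) (+-nonNeg (*-nonNeg l₁ (+-nonNeg l₂ 18σ)) (*-nonNeg 18σ l₂)))
        (*-nonNeg (+-nonNeg (+-nonNeg u₁ u₂) l₃)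
                  (+-nonNeg (+-nonNeg (+-nonNeg l₁ l₂) u₃) (*-nonNeg (#-nonNeg 40) 0≤σ))))
      (solve 4 (λ σ X Y Z →
        let L₁ = X :- con (+ 18) :* σ ; U₁ = con (+ 22) :* σ :- X
            L₂ = Y :- con (+ 18) :* σ ; U₂ = con (+ 22) :* σ :- Y
            L₃ = Z :- con (+ 18) :* σ ; U₃ = con (+ 22) :* σ :- Z
        in con (+ 4) :* (L₁ :* (L₂ :+ con (+ 18) :* σ) :+ con (+ 18) :* σ :* L₂) :+
           (U₁ :+ U₂ :+ L₃) :* (L₁ :+ L₂ :+ U₃ :+ con (+ 40) :* σ) :=
           con (+ 4) :* (X :* Y) :- (X :+ Y :- Z) :* (X :+ Y :- Z) :- con (+ 620) :* (σ :* σ))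
        refl σ X Y Z)
      where 18σ = *-nonNeg (#-nonNeg 18) 0≤σ

  cross²-positive : ∀ {σ} p q → Positive σ → Near σ (norm² p) → Near σ (norm² q) →
                    Near σ (dist² p q) → Positive (cross p q * cross p q)
  cross²-positive p q σ>0 np nq npq = *-cancelˡ-positive (#-nonNeg 1600)
    (positive-≤ (*-positive (#-positive 619) (*-positive σ>0 σ>0))
      (cross-bound p q (positive⇒nonNeg σ>0) np nq npq))

  Adj-based : ∀ {σ} O P → Adj σ O P → Near σ (norm² (P ⊖ O))
  Adj-based (x₀ , y₀) (x₁ , y₁) = Near-resp (dist²-sym (x₀ , y₀) (x₁ , y₁))

  -- Collinearity is the vanishing of a cross product of edge vectors, which `cross-bound` forbids.
  -- This supplies the nondegeneracy demanded of the constructed triangles.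
  Adj⇒nonCollinear : ∀ {σ} P Q R → Positive σ → Adj σ P Q → Adj σ P R → Adj σ Q R →
                     ¬ Collinear P Q R
  Adj⇒nonCollinear P Q R σ>0 PQ PR QR col = positive⇒≉0
    (cross²-positive (Q ⊖ P) (R ⊖ P) σ>0 (Adj-based P Q PQ) (Adj-based P R PR)
      (Near-resp (dist²-⊖ P Q R) QR))
    (trans (*-congʳ (trans (+-congʳ col) (-‿inverseʳ _))) (zeroˡ _))

  -- The Gram form written by polarisation in terms of the six squared distances among the origin,
  -- p, q and r, since these are what `Near` controls.
  gram : ∀ α β γ → Point → Point → Point → Carrier
  gram α β γ p q r =
    norm² p * (α * (α + β + γ)) + norm² q * (β * (α + β + γ)) + norm² r * (γ * (α + β + γ))
    - dist² p q * (α * β) - dist² p r * (α * γ) - dist² q r * (β * γ)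

  -- The form below is |α p + β q + γ r|², and these coefficients are a linear
  -- dependency.
  gram-cross : ∀ p q r → gram (cross q r) (cross r p) (cross p q) p q r ≈ 0#
  gram-cross p@(p₁ , p₂) q@(q₁ , q₂) r@(r₁ , r₂) =
    trans (expand _ _ _ p₁ p₂ q₁ q₂ r₁ r₂) (trans (+-cong (*-cong dep₁ dep₁) (*-cong dep₂ dep₂))
      (solve 0 (con (+ 0) :* con (+ 0) :+ con (+ 0) :* con (+ 0) := con (+ 0)) refl))
    where
    expand : ∀ α β γ p₁ p₂ q₁ q₂ r₁ r₂ →
      gram α β γ (p₁ , p₂) (q₁ , q₂) (r₁ , r₂) ≈
      (α * p₁ + β * q₁ + γ * r₁) * (α * p₁ + β * q₁ + γ * r₁) +
      (α * p₂ + β * q₂ + γ * r₂) * (α * p₂ + β * q₂ + γ * r₂)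
    expand = solve 9 (λ α β γ p₁ p₂ q₁ q₂ r₁ r₂ →
      (p₁ :* p₁ :+ p₂ :* p₂) :* (α :* (α :+ β :+ γ)) :+
      (q₁ :* q₁ :+ q₂ :* q₂) :* (β :* (α :+ β :+ γ)) :+
      (r₁ :* r₁ :+ r₂ :* r₂) :* (γ :* (α :+ β :+ γ))
      :- ((p₁ :- q₁) :* (p₁ :- q₁) :+ (p₂ :- q₂) :* (p₂ :- q₂)) :* (α :* β)
      :- ((p₁ :- r₁) :* (p₁ :- r₁) :+ (p₂ :- r₂) :* (p₂ :- r₂)) :* (α :* γ)
      :- ((q₁ :- r₁) :* (q₁ :- r₁) :+ (q₂ :- r₂) :* (q₂ :- r₂)) :* (β :* γ) :=
      (α :* p₁ :+ β :* q₁ :+ γ :* r₁) :* (α :* p₁ :+ β :* q₁ :+ γ :* r₁) :+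
      (α :* p₂ :+ β :* q₂ :+ γ :* r₂) :* (α :* p₂ :+ β :* q₂ :+ γ :* r₂)) refl

    dep₁ : cross q r * p₁ + cross r p * q₁ + cross p q * r₁ ≈ 0#
    dep₁ = solve 6 (λ p₁ p₂ q₁ q₂ r₁ r₂ →
      (q₁ :* r₂ :- q₂ :* r₁) :* p₁ :+ (r₁ :* p₂ :- r₂ :* p₁) :* q₁ :+
      (p₁ :* q₂ :- p₂ :* q₁) :* r₁ := con (+ 0)) refl p₁ p₂ q₁ q₂ r₁ r₂

    dep₂ : cross q r * p₂ + cross r p * q₂ + cross p q * r₂ ≈ 0#
    dep₂ = solve 6 (λ p₁ p₂ q₁ q₂ r₁ r₂ →
      (q₁ :* r₂ :- q₂ :* r₁) :* p₂ :+ (r₁ :* p₂ :- r₂ :* p₁) :* q₂ :+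
      (p₁ :* q₂ :- p₂ :* q₁) :* r₂ := con (+ 0)) refl p₁ p₂ q₁ q₂ r₁ r₂

  -- When all six distances equal √σ, twice the form is
  -- σ (α² + β² + γ² + (α + β + γ)²); the hypotheses leave this dominant.
  gram-bound : ∀ {σ} α β γ p q r → 0# ≤ σ →
    Near σ (norm² p) → Near σ (norm² q) → Near σ (norm² r) →
    Near σ (dist² p q) → Near σ (dist² p r) → Near σ (dist² q r) →
    # 8 * (σ * (α * α + β * β + γ * γ)) ≤ # 80 * gram α β γ p q r
  gram-bound {σ} α β γ p q r 0≤σ (l₁ , u₁) (l₂ , u₂) (l₃ , u₃) (l₄ , u₄) (l₅ , u₅) (l₆ , u₆) =
    0≤y-x⇒x≤y (≤-respʳ
      (+-nonNeg (+-nonNeg (+-nonNeg (*-nonNeg (*-nonNeg (#-nonNeg 40) 0≤σ) (sq-nonNeg (α + β + γ)))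
        (+-nonNeg (+-nonNeg (diagonal α l₁) (diagonal β l₂)) (diagonal γ l₃)))
        (pair α β l₁ u₁ l₂ u₂ l₄ u₄))
        (+-nonNeg (pair α γ l₁ u₁ l₃ u₃ l₅ u₅) (pair β γ l₂ u₂ l₃ u₃ l₆ u₆)))
      (collect α β γ (norm² p) (norm² q) (norm² r) (dist² p q) (dist² p r) (dist² q r)))
    where
    diagonal : ∀ {D} x → # 18 * σ ≤ # 20 * D → 0# ≤ # 4 * ((x * x) * (# 20 * D - # 18 * σ))
    diagonal x l = *-nonNeg (#-nonNeg 4) (*-nonNeg (sq-nonNeg x) (x≤y⇒0≤y-x l))

    -- With W = 20D + 20E - 20F, the hypotheses place W between 14σ and 26σ, so it deviates from 20σ
    -- by at most 6σ, and 24σ|xy| ≤ 12σ(x² + y²). The certificate (x + y)²(W - 14σ) + (x - y)²(26σ -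
    -- W) avoids a case split on the sign of xy.
    pair : ∀ {D E F} x y →
      # 18 * σ ≤ # 20 * D → # 20 * D ≤ # 22 * σ →
      # 18 * σ ≤ # 20 * E → # 20 * E ≤ # 22 * σ →
      # 18 * σ ≤ # 20 * F → # 20 * F ≤ # 22 * σ →
      0# ≤ # 4 * (x * y * (# 20 * D + # 20 * E - # 20 * F - # 20 * σ)) + # 12 * σ * (x * x + y * y)
    pair {D} {E} {F} x y l₁ u₁ l₂ u₂ l₃ u₃ = ≤-respʳ
      (+-nonNeg
        (*-nonNeg (sq-nonNeg (x + y)) (+-nonNeg (+-nonNeg (x≤y⇒0≤y-x l₁) (x≤y⇒0≤y-x l₂)) (x≤y⇒0≤y-x u₃)))
        (*-nonNeg (sq-nonNeg (x - y)) (+-nonNeg (+-nonNeg (x≤y⇒0≤y-x u₁) (x≤y⇒0≤y-x u₂)) (x≤y⇒0≤y-x l₃))))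
      (solve 6 (λ σ x y D E F →
        let X = con (+ 20) :* D ; Y = con (+ 20) :* E ; Z = con (+ 20) :* F
            18σ = con (+ 18) :* σ ; 22σ = con (+ 22) :* σ
        in (x :+ y) :* (x :+ y) :* ((X :- 18σ) :+ (Y :- 18σ) :+ (22σ :- Z)) :+
           (x :- y) :* (x :- y) :* ((22σ :- X) :+ (22σ :- Y) :+ (Z :- 18σ)) :=
           con (+ 4) :* (x :* y :* (X :+ Y :- Z :- con (+ 20) :* σ)) :+
           con (+ 12) :* σ :* (x :* x :+ y :* y)) refl σ x y D E F)

    -- Balance of the coefficients of σ(α² + β² + γ²): the ideal form has 40, the diagonal entries
    -- may lose 80 - 72 = 8, and the three off-diagonal pairs lose 24 together, since each variable
    -- occurs in two of them. This leaves 8.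
    collect : ∀ α β γ A B C D E F →
      # 40 * σ * ((α + β + γ) * (α + β + γ)) +
      (# 4 * ((α * α) * (# 20 * A - # 18 * σ)) + # 4 * ((β * β) * (# 20 * B - # 18 * σ))
        + # 4 * ((γ * γ) * (# 20 * C - # 18 * σ))) +
      (# 4 * (α * β * (# 20 * A + # 20 * B - # 20 * D - # 20 * σ)) + # 12 * σ * (α * α + β * β)) +
      ((# 4 * (α * γ * (# 20 * A + # 20 * C - # 20 * E - # 20 * σ)) + # 12 * σ * (α * α + γ * γ)) +
       (# 4 * (β * γ * (# 20 * B + # 20 * C - # 20 * F - # 20 * σ)) + # 12 * σ * (β * β + γ * γ)))
      ≈ # 80 * (A * (α * (α + β + γ)) + B * (β * (α + β + γ)) + C * (γ * (α + β + γ))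
          - D * (α * β) - E * (α * γ) - F * (β * γ)) - # 8 * (σ * (α * α + β * β + γ * γ))
    collect α β γ A B C D E F = solve 10 (λ σ α β γ A B C D E F →
      let S = α :+ β :+ γ
          N = α :* α :+ β :* β :+ γ :* γ
          diag = λ x D → con (+ 4) :* ((x :* x) :* (con (+ 20) :* D :- con (+ 18) :* σ))
          off  = λ x y D E F → con (+ 4) :* (x :* y :*
                   (con (+ 20) :* D :+ con (+ 20) :* E :- con (+ 20) :* F :- con (+ 20) :* σ))
                   :+ con (+ 12) :* σ :* (x :* x :+ y :* y)
      in con (+ 40) :* σ :* (S :* S) :+ (diag α A :+ diag β B :+ diag γ C) :+ off α β A B D :+
         (off α γ A C E :+ off β γ B C F) :=
         con (+ 80) :* (A :* (α :* S) :+ B :* (β :* S) :+ C :* (γ :* S)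
           :- D :* (α :* β) :- E :* (α :* γ) :- F :* (β :* γ)) :- con (+ 8) :* (σ :* N))
      refl σ α β γ A B C D E F

  Adj-K₄-free : ∀ {σ} O P Q R → Positive σ → Adj σ O P → Adj σ O Q → Adj σ O R →
                Adj σ P Q → Adj σ P R → Adj σ Q R → ⊥
  Adj-K₄-free {σ} O P Q R σ>0 OP OQ OR PQ PR QR =
    positive-≤ (*-positive (#-positive 7) (*-positive σ>0 squares>0))
      (gram-bound (cross q r) (cross r p) (cross p q) p q r (positive⇒nonNeg σ>0) np nq nr npq
        (Near-resp (dist²-⊖ O P R) PR) (Near-resp (dist²-⊖ O Q R) QR))
      (≤-reflexive (trans (*-congˡ (gram-cross p q r)) (zeroʳ _)))
    where
    -- With O moved to the origin, four points become three plane vectors, whose linear dependency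
    -- makes the form vanish.
    p = P ⊖ O
    q = Q ⊖ O
    r = R ⊖ O
    np = Adj-based O P OP
    nq = Adj-based O Q OQ
    nr = Adj-based O R OR
    npq = Near-resp (dist²-⊖ O P Q) PQ

    -- One nonzero coefficient already makes the dependency nontrivial, so that the vanishing form
    -- contradicts `gram-bound`.
    squares>0 : Positive (cross q r * cross q r + cross r p * cross r p + cross p q * cross p q)
    squares>0 = positive-≤ (cross²-positive p q σ>0 np nq npq)
      (0≤y-x⇒x≤y (≤-respʳ (+-nonNeg (sq-nonNeg (cross q r)) (sq-nonNeg (cross r p)))
        (solve 3 (λ a b c → a :+ b := a :+ b :+ c :- c) refl
          (cross q r * cross q r) (cross r p * cross r p) (cross p q * cross p q))))

  -- Let w = A - B and let z be the change of this difference. Of the spare 2|w|² in 20|w - z|² -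
  -- 18|w|² or in 22|w|² - 20|w - z|², one copy completes a square with the cross term; the other
  -- must cover 380|z|² or 420|z|². As |z|² ≤ 4ρ², that takes at most 1680ρ², and 50² = 2500
  -- suffices.
  perturb : ∀ {s ρ} A B A′ B′ → 0# ≤ ρ → # 50 * ρ ≤ s → s * s ≈ dist² A B →
            dist² A A′ ≤ ρ * ρ → dist² B B′ ≤ ρ * ρ → Near (s * s) (dist² A′ B′)
  perturb {s} {ρ} A@(a₁ , a₂) B@(b₁ , b₂) A′@(a₁′ , a₂′) B′@(b₁′ , b₂′) 0≤ρ 50ρ≤s ss≈ AA′ BB′ =
    Near-resp (sym difference) (lower , upper)
    where
    w₁ = a₁ - b₁
    w₂ = a₂ - b₂
    z₁ = (a₁ - a₁′) - (b₁ - b₁′)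
    z₂ = (a₂ - a₂′) - (b₂ - b₂′)
    Z = z₁ * z₁ + z₂ * z₂
    W = w₁ * w₁ + w₂ * w₂
    R = ρ * ρ
    D = (w₁ - z₁) * (w₁ - z₁) + (w₂ - z₂) * (w₂ - z₂)

    difference : dist² A′ B′ ≈ D
    difference = +-cong (sq a₁ b₁ a₁′ b₁′) (sq a₂ b₂ a₂′ b₂′)
      where
      sq : ∀ a b a′ b′ → (a′ - b′) * (a′ - b′) ≈
           ((a - b) - ((a - a′) - (b - b′))) * ((a - b) - ((a - a′) - (b - b′)))
      sq = solve 4 (λ a b a′ b′ → (a′ :- b′) :* (a′ :- b′) :=
           ((a :- b) :- ((a :- a′) :- (b :- b′))) :* ((a :- b) :- ((a :- a′) :- (b :- b′)))) refl

    -- The parallelogram law |u - v|² + |u + v|² = 2|u|² + 2|v|² for the two displacements u and v.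
    Z≤4R : 0# ≤ # 4 * R - Z
    Z≤4R = ≤-respʳ
      (+-nonNeg (*-nonNeg (#-nonNeg 2) (+-nonNeg (x≤y⇒0≤y-x AA′) (x≤y⇒0≤y-x BB′)))
        (+-nonNeg (sq-nonNeg ((a₁ - a₁′) + (b₁ - b₁′))) (sq-nonNeg ((a₂ - a₂′) + (b₂ - b₂′)))))
      (solve 5 (λ R u₁ u₂ v₁ v₂ →
        con (+ 2) :* ((R :- (u₁ :* u₁ :+ u₂ :* u₂)) :+ (R :- (v₁ :* v₁ :+ v₂ :* v₂))) :+
        ((u₁ :+ v₁) :* (u₁ :+ v₁) :+ (u₂ :+ v₂) :* (u₂ :+ v₂)) :=
        con (+ 4) :* R :- ((u₁ :- v₁) :* (u₁ :- v₁) :+ (u₂ :- v₂) :* (u₂ :- v₂)))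
        refl R (a₁ - a₁′) (a₂ - a₂′) (b₁ - b₁′) (b₂ - b₂′))

    2500R≤W : 0# ≤ W - # 2500 * R
    2500R≤W = ≤-respʳ (x≤y⇒0≤y-x (sq-mono-≤ (*-nonNeg (#-nonNeg 50) 0≤ρ) 50ρ≤s))
      (trans (+-congʳ ss≈)
        (solve 2 (λ W ρ → W :- con (+ 50) :* ρ :* (con (+ 50) :* ρ) :=
                          W :- con (+ 2500) :* (ρ :* ρ)) refl W ρ))

    -- |w ± 20 z|² ≥ 0 absorbs the cross term 2 w · z.
    lower : # 18 * (s * s) ≤ # 20 * D
    lower = ≤-respˡ (*-congˡ ss≈) (0≤y-x⇒x≤y (≤-respʳ
      (+-nonNeg (+-nonNeg (sq-nonNeg (w₁ - # 20 * z₁)) (sq-nonNeg (w₂ - # 20 * z₂)))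
        (+-nonNeg 2500R≤W
          (+-nonNeg (*-nonNeg (#-nonNeg 980) (sq-nonNeg ρ)) (*-nonNeg (#-nonNeg 380) Z≤4R))))
      (solve 5 (λ R w₁ w₂ z₁ z₂ →
        ((w₁ :- con (+ 20) :* z₁) :* (w₁ :- con (+ 20) :* z₁) :+
         (w₂ :- con (+ 20) :* z₂) :* (w₂ :- con (+ 20) :* z₂)) :+
        ((w₁ :* w₁ :+ w₂ :* w₂ :- con (+ 2500) :* R) :+ (con (+ 980) :* R :+
          con (+ 380) :* (con (+ 4) :* R :- (z₁ :* z₁ :+ z₂ :* z₂)))) :=
        con (+ 20) :* ((w₁ :- z₁) :* (w₁ :- z₁) :+ (w₂ :- z₂) :* (w₂ :- z₂)) :-
        con (+ 18) :* (w₁ :* w₁ :+ w₂ :* w₂)) refl R w₁ w₂ z₁ z₂)))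

    upper : # 20 * D ≤ # 22 * (s * s)
    upper = ≤-respʳ (0≤y-x⇒x≤y (≤-respʳ
      (+-nonNeg (+-nonNeg (sq-nonNeg (w₁ + # 20 * z₁)) (sq-nonNeg (w₂ + # 20 * z₂)))
        (+-nonNeg 2500R≤W
          (+-nonNeg (*-nonNeg (#-nonNeg 820) (sq-nonNeg ρ)) (*-nonNeg (#-nonNeg 420) Z≤4R))))
      (solve 5 (λ R w₁ w₂ z₁ z₂ →
        ((w₁ :+ con (+ 20) :* z₁) :* (w₁ :+ con (+ 20) :* z₁) :+
         (w₂ :+ con (+ 20) :* z₂) :* (w₂ :+ con (+ 20) :* z₂)) :+
        ((w₁ :* w₁ :+ w₂ :* w₂ :- con (+ 2500) :* R) :+ (con (+ 820) :* R :+
          con (+ 420) :* (con (+ 4) :* R :- (z₁ :* z₁ :+ z₂ :* z₂)))) :=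
        con (+ 22) :* (w₁ :* w₁ :+ w₂ :* w₂) :-
        con (+ 20) :* ((w₁ :- z₁) :* (w₁ :- z₁) :+ (w₂ :- z₂) :* (w₂ :- z₂))) refl R w₁ w₂ z₁ z₂)))
      (*-congˡ (sym ss≈))

  closedDisk⇒dist² : ∀ {A ρ A′} → InClosedDisk A ρ A′ → 0# ≤ ρ × dist² A A′ ≤ ρ * ρ
  closedDisk⇒dist² (d , (0≤d , dd≈) , d≤ρ) = ≤-trans 0≤d d≤ρ , ≤-respˡ (sym dd≈) (sq-mono-≤ 0≤d d≤ρ)

  close⇒Adj : ∀ {s ρ A B A′ B′} → # 50 * ρ ≤ s → IsDist A B s →
              InClosedDisk A ρ A′ → InClosedDisk B ρ B′ → Adj (s * s) A′ B′
  close⇒Adj {A = A} {B} {A′} {B′} 50ρ≤s (_ , ss≈) AA′ BB′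
    with closedDisk⇒dist² AA′ | closedDisk⇒dist² BB′
  ... | 0≤ρ , a | _ , b = perturb A B A′ B′ 0≤ρ 50ρ≤s ss≈ a b

-- Sums over unordered pairs and triples of list positions.

module Counting where
  open import Data.List.Relation.Binary.Permutation.Propositional
    using (_↭_; refl; prep; swap; trans; ↭-refl; ↭-sym; ↭-trans)
  open import Data.Nat.Base using (_+_; _*_; _/_; _≤_; _<_; z≤n; s≤s)
  open import Data.Nat.DivMod using (+-distrib-/-∣ˡ)
  open import Data.Nat.Divisibility using (∣-refl)
  open import Data.Nat.ListAction using (sum)
  open import Data.Nat.ListAction.Properties using (sum-↭)
  open import Data.Nat.Properties
  open import Data.Nat.Tactic.RingSolver using (solve-∀)
  open import Algebra.Properties.CommutativeSemigroup +-commutativeSemigroup using (interchange)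
  open import Relation.Binary.PropositionalEquality.Core using (refl; cong; cong₂; sym; subst)

  module _ {V : Set} where

    singleSum : (V → ℕ) → List V → ℕ
    singleSum f xs = sum (map f xs)

    pairSum : (V → V → ℕ) → List V → ℕ
    pairSum g []       = 0
    pairSum g (x ∷ xs) = singleSum (g x) xs + pairSum g xs

    tripleSum : (V → V → V → ℕ) → List V → ℕ
    tripleSum h []       = 0
    tripleSum h (x ∷ xs) = pairSum (h x) xs + tripleSum h xs

    singleSum-+ : ∀ f f′ xs → singleSum (λ x → f x + f′ x) xs ≡ singleSum f xs + singleSum f′ xs
    singleSum-+ f f′ []       = refl
    singleSum-+ f f′ (x ∷ xs) rewrite singleSum-+ f f′ xs = interchange (f x) (f′ x) _ _

    pairSum-+ : ∀ g g′ xs → pairSum (λ x y → g x y + g′ x y) xs ≡ pairSum g xs + pairSum g′ xs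
    pairSum-+ g g′ []       = refl
    pairSum-+ g g′ (x ∷ xs)
      rewrite pairSum-+ g g′ xs | singleSum-+ (g x) (g′ x) xs =
      interchange (singleSum (g x) xs) (singleSum (g′ x) xs) _ _

    singleSum-mono : ∀ {f f′} → (∀ x → f x ≤ f′ x) → ∀ xs → singleSum f xs ≤ singleSum f′ xs
    singleSum-mono f≤f′ []       = z≤n
    singleSum-mono f≤f′ (x ∷ xs) = +-mono-≤ (f≤f′ x) (singleSum-mono f≤f′ xs)

    pairSum-mono : ∀ {g g′} → (∀ x y → g x y ≤ g′ x y) → ∀ xs → pairSum g xs ≤ pairSum g′ xs
    pairSum-mono g≤g′ []       = z≤n
    pairSum-mono g≤g′ (x ∷ xs) = +-mono-≤ (singleSum-mono (g≤g′ x) xs) (pairSum-mono g≤g′ xs)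

    singleSum-const : ∀ c xs → singleSum (λ _ → c) xs ≡ length xs * c
    singleSum-const c []       = refl
    singleSum-const c (x ∷ xs) = cong (λ m → c + m) (singleSum-const c xs)

    singleSum-↭ : ∀ f {xs ys} → xs ↭ ys → singleSum f xs ≡ singleSum f ys
    singleSum-↭ f p = sum-↭ (↭-map⁺ f p)

    pairSum-↭ : ∀ g → (∀ x y → g x y ≡ g y x) → ∀ {xs ys} → xs ↭ ys → pairSum g xs ≡ pairSum g ys
    pairSum-↭ g g-sym refl        = refl
    pairSum-↭ g g-sym (prep x p)  = cong₂ _+_ (singleSum-↭ (g x) p) (pairSum-↭ g g-sym p)
    pairSum-↭ g g-sym (trans p q) = ≡.trans (pairSum-↭ g g-sym p) (pairSum-↭ g g-sym q)
    pairSum-↭ g g-sym {_} {_ ∷ _ ∷ ys} (swap x y p)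
      rewrite g-sym x y | singleSum-↭ (g x) p | singleSum-↭ (g y) p | pairSum-↭ g g-sym p =
      interchange (g y x) (singleSum (g x) ys) _ _

    -- The two transpositions generate all relabellings of a triple. Invariance allows a chosen
    -- triangle to be moved to the front of the vertex list and split off.
    tripleSum-↭ : ∀ h → (∀ x y z → h x y z ≡ h y x z) → (∀ x y z → h x y z ≡ h x z y) →
                  ∀ {xs ys} → xs ↭ ys → tripleSum h xs ≡ tripleSum h ys
    tripleSum-↭ h s₁ s₂ refl        = refl
    tripleSum-↭ h s₁ s₂ (prep x p)  = cong₂ _+_ (pairSum-↭ (h x) (s₂ x) p) (tripleSum-↭ h s₁ s₂ p)
    tripleSum-↭ h s₁ s₂ (trans p q) = ≡.trans (tripleSum-↭ h s₁ s₂ p) (tripleSum-↭ h s₁ s₂ q)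
    tripleSum-↭ h s₁ s₂ {_} {_ ∷ _ ∷ ys} (swap x y p)
      rewrite singleSum-↭ (h x y) p | pairSum-↭ (h x) (s₂ x) p | pairSum-↭ (h y) (s₂ y) p
            | tripleSum-↭ h s₁ s₂ p | cong sum (List.map-cong (s₁ x y) ys) =
      interchange (singleSum (h y x) ys) (pairSum (h x) ys) _ _

    singleSum-∃ : ∀ f xs → singleSum f xs ≡ 0 ⊎ ∃ λ a → ∃ λ ys → xs ↭ a ∷ ys × 0 < f a
    singleSum-∃ f [] = inj₁ refl
    singleSum-∃ f (x ∷ xs) with f x in eq
    ... | suc _ = inj₂ (x , xs , ↭-refl , subst (0 <_) (sym eq) (s≤s z≤n))
    ... | zero with singleSum-∃ f xs
    ...   | inj₁ eq′             = inj₁ eq′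
    ...   | inj₂ (a , ys , p , q) =
      inj₂ (a , x ∷ ys , ↭-trans (prep x p) (↭-sym (shift x (a ∷ []) ys)) , q)

    pairSum-∃ : ∀ g xs → pairSum g xs ≡ 0 ⊎
                ∃ λ a → ∃ λ b → ∃ λ ys → xs ↭ a ∷ b ∷ ys × 0 < g a b
    pairSum-∃ g [] = inj₁ refl
    pairSum-∃ g (x ∷ xs) with singleSum-∃ (g x) xs
    ... | inj₂ (a , ys , p , q) = inj₂ (x , a , ys , prep x p , q)
    ... | inj₁ eq with pairSum-∃ g xs
    ...   | inj₁ eq′                 = inj₁ (cong₂ _+_ eq eq′)
    ...   | inj₂ (a , b , ys , p , q) =
      inj₂ (a , b , x ∷ ys , ↭-trans (prep x p) (↭-sym (shift x (a ∷ b ∷ []) ys)) , q)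

    tripleSum-∃ : ∀ h xs → tripleSum h xs ≡ 0 ⊎
                  ∃ λ a → ∃ λ b → ∃ λ c → ∃ λ ys → xs ↭ a ∷ b ∷ c ∷ ys × 0 < h a b c
    tripleSum-∃ h [] = inj₁ refl
    tripleSum-∃ h (x ∷ xs) with pairSum-∃ (h x) xs
    ... | inj₂ (a , b , ys , p , q) = inj₂ (x , a , b , ys , prep x p , q)
    ... | inj₁ eq with tripleSum-∃ h xs
    ...   | inj₁ eq′                     = inj₁ (cong₂ _+_ eq eq′)
    ...   | inj₂ (a , b , c , ys , p , q) =
      inj₂ (a , b , c , x ∷ ys , ↭-trans (prep x p) (↭-sym (shift x (a ∷ b ∷ c ∷ []) ys)) , q)

    pairSum-split : ∀ g a b c ys → pairSum g (a ∷ b ∷ c ∷ ys) ≡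
      g a b + g a c + g b c + singleSum (λ z → g a z + g b z + g c z) ys + pairSum g ys
    pairSum-split g a b c ys
      rewrite singleSum-+ (λ z → g a z + g b z) (g c) ys | singleSum-+ (g a) (g b) ys =
      rearrange (g a b) (g a c) (g b c) (singleSum (g a) ys) (singleSum (g b) ys) (singleSum (g c) ys) _
      where
      rearrange : ∀ ab ac bc a b c r →
        (ab + (ac + a)) + ((bc + b) + (c + r)) ≡ ab + ac + bc + (a + b + c) + r
      rearrange = solve-∀

    tripleSum-split : ∀ h a b c ys → tripleSum h (a ∷ b ∷ c ∷ ys) ≡
      h a b c + singleSum (λ z → h a b z + h a c z + h b c z) ys
              + pairSum (λ x y → h a x y + h b x y + h c x y) ys + tripleSum h ys
    tripleSum-split h a b c ys
      rewrite singleSum-+ (λ z → h a b z + h a c z) (h b c) ys | singleSum-+ (h a b) (h a c) ys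
            | pairSum-+ (λ x y → h a x y + h b x y) (h c) ys | pairSum-+ (h a) (h b) ys =
      rearrange (h a b c) (singleSum (h a b) ys) (singleSum (h a c) ys) (singleSum (h b c) ys)
        (pairSum (h a) ys) (pairSum (h b) ys) (pairSum (h c) ys) _
      where
      rearrange : ∀ abc ab ac bc a b c r →
        ((abc + ab) + (ac + a)) + ((bc + b) + (c + r)) ≡ abc + (ab + ac + bc) + (a + b + c) + r
      rearrange = solve-∀

  -- turánEdges n and turánTriangles n count the edges and the triangles of the
  -- balanced complete tripartite graph on n vertices.
  turánEdges : ℕ → ℕ
  turánEdges 0 = 0
  turánEdges 1 = 0
  turánEdges 2 = 1
  turánEdges (suc (suc (suc n))) = 3 + n * 2 + turánEdges n

  turánTriangles : ℕ → ℕ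
  turánTriangles 0 = 0
  turánTriangles 1 = 0
  turánTriangles 2 = 0
  turánTriangles (suc (suc (suc n))) = 1 + n + turánEdges n + turánTriangles n

  indicator : Bool → ℕ
  indicator b = if b then 1 else 0

  indicator≤1 : ∀ b → indicator b ≤ 1
  indicator≤1 true  = s≤s z≤n
  indicator≤1 false = z≤n

  0<indicator : ∀ {b} → 0 < indicator b → b ≡ true
  0<indicator {true} _ = refl

  -- Zykov's theorem for graphs without K₄.

  module CliqueCount {V : Set} (adj : V → V → Bool) (adj-sym : ∀ x y → adj x y ≡ adj y x) where

    edge : V → V → ℕ
    edge x y = indicator (adj x y)

    triangle : V → V → V → ℕ
    triangle x y z = indicator (adj x y ∧ adj x z ∧ adj y z)

    edge-sym : ∀ x y → edge x y ≡ edge y x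
    edge-sym x y = cong indicator (adj-sym x y)

    triangle-sym₁ : ∀ x y z → triangle x y z ≡ triangle y x z
    triangle-sym₁ x y z rewrite adj-sym x y with adj y x | adj x z | adj y z
    ... | false | _     | _     = refl
    ... | true  | false | false = refl
    ... | true  | false | true  = refl
    ... | true  | true  | false = refl
    ... | true  | true  | true  = refl

    triangle-sym₂ : ∀ x y z → triangle x y z ≡ triangle x z y
    triangle-sym₂ x y z rewrite adj-sym y z with adj x y | adj x z | adj z y
    ... | false | false | _ = refl
    ... | false | true  | _ = refl
    ... | true  | false | _ = refl
    ... | true  | true  | _ = refl

    0<triangle : ∀ {x y z} → 0 < triangle x y z → adj x y ≡ true × adj x z ≡ true × adj y z ≡ true
    0<triangle {x} {y} {z} p with adj x y | adj x z | adj y z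
    ... | true | true | true = refl , refl , refl

    triangle>0 : ∀ {x y z} → adj x y ≡ true → adj x z ≡ true → adj y z ≡ true → 0 < triangle x y z
    triangle>0 xy xz yz rewrite xy | xz | yz = s≤s z≤n

    module _ (K₄-free : ∀ {w x y z} → adj w x ≡ true → adj w y ≡ true → adj w z ≡ true →
                        adj x y ≡ true → adj x z ≡ true → adj y z ≡ true → ⊥) where

      private
        at-most-one : ∀ p q r → (p ≡ true → q ≡ true → ⊥) → (p ≡ true → r ≡ true → ⊥) →
          (q ≡ true → r ≡ true → ⊥) → indicator p + indicator q + indicator r ≤ 1
        at-most-one true  true  _     pq _  _  = ⊥-elim (pq refl refl)
        at-most-one true  false true  _  pr _  = ⊥-elim (pr refl refl)
        at-most-one true  false false _  _  _  = s≤s z≤n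
        at-most-one false true  true  _  _  qr = ⊥-elim (qr refl refl)
        at-most-one false true  false _  _  _  = s≤s z≤n
        at-most-one false false r     _  _  _  = indicator≤1 r

        not-all : ∀ p q r → (p ≡ true → q ≡ true → r ≡ true → ⊥) →
          indicator (p ∧ q) + indicator (p ∧ r) + indicator (q ∧ r) ≤ 1 ×
          indicator p + indicator q + indicator r ≤ 2
        not-all true  true  true  ¬pqr = ⊥-elim (¬pqr refl refl refl)
        not-all true  true  false _ = s≤s z≤n , s≤s (s≤s z≤n)
        not-all true  false true  _ = s≤s z≤n , s≤s (s≤s z≤n)
        not-all true  false false _ = z≤n , s≤s z≤n
        not-all false true  true  _ = s≤s z≤n , s≤s (s≤s z≤n)
        not-all false true  false _ = z≤n , s≤s z≤n
        not-all false false true  _ = z≤n , s≤s z≤n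
        not-all false false false _ = z≤n , z≤n

        two-plus : ∀ p q r → indicator p + indicator q + indicator r ≤ 2 + indicator (p ∧ q)
        two-plus true  true  r = s≤s (s≤s (indicator≤1 r))
        two-plus true  false r = s≤s (indicator≤1 r)
        two-plus false true  r = s≤s (indicator≤1 r)
        two-plus false false r = ≤-trans (indicator≤1 r) (s≤s z≤n)

        ∧-true : ∀ {p q} → p ∧ q ≡ true → p ≡ true × q ≡ true
        ∧-true {true} {true} _ = refl , refl

      module _ {a b c} (ab : adj a b ≡ true) (ac : adj a c ≡ true) (bc : adj b c ≡ true) where

        edges-to-triangle : ∀ z → edge a z + edge b z + edge c z ≤ 2
        edges-to-triangle z =
          proj₂ (not-all (adj a z) (adj b z) (adj c z) λ az bz cz → K₄-free ab ac az bc bz cz)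

        triangles-on-two : ∀ z → triangle a b z + triangle a c z + triangle b c z ≤ 1
        triangles-on-two z rewrite ab | ac | bc =
          proj₁ (not-all (adj a z) (adj b z) (adj c z) λ az bz cz → K₄-free ab ac az bc bz cz)

        -- If two of a, b, c were both joined to x and y, then, being adjacent themselves, they
        -- would form a K₄ with an edge xy. A non-edge xy contributes nothing.
        triangles-on-one : ∀ x y → triangle a x y + triangle b x y + triangle c x y ≤ edge x y
        triangles-on-one x y with adj x y in xy
        ... | false
          rewrite ∧-zeroʳ (adj a y) | ∧-zeroʳ (adj a x) | ∧-zeroʳ (adj b y) | ∧-zeroʳ (adj b x)
                | ∧-zeroʳ (adj c y) | ∧-zeroʳ (adj c x) = z≤n
        ... | true = at-most-one (adj a x ∧ adj a y ∧ true) (adj b x ∧ adj b y ∧ true)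
                       (adj c x ∧ adj c y ∧ true) (clash ab) (clash ac) (clash bc)
          where
          clash : ∀ {u v} → adj u v ≡ true → adj u x ∧ adj u y ∧ true ≡ true →
                  adj v x ∧ adj v y ∧ true ≡ true → ⊥
          clash uv ux∧uy vx∧vy with ∧-true ux∧uy | ∧-true vx∧vy
          ... | ux , uy∧ | vx , vy∧ = K₄-free uv ux (proj₁ (∧-true uy∧)) vx (proj₁ (∧-true vy∧)) xy

      -- Edges inside the deleted triple are bounded trivially by 3, so a, b, c need not form a
      -- triangle and both cases of the induction can use this step.
      edges-bound : ∀ {n} a b c ys → length ys ≡ n → pairSum edge ys ≤ turánEdges n →
        singleSum (λ z → edge a z + edge b z + edge c z) ys ≤ n * 2 →
        pairSum edge (a ∷ b ∷ c ∷ ys) ≤ turánEdges (3 + n)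
      edges-bound a b c ys refl ih outer = ≤-trans (≤-reflexive (pairSum-split edge a b c ys))
        (+-mono-≤ (+-mono-≤ (+-mono-≤ (+-mono-≤ (indicator≤1 (adj a b)) (indicator≤1 (adj a c)))
          (indicator≤1 (adj b c))) outer) ih)

      -- Delete a triangle, on which every other vertex has at most two neighbours
      -- and every other edge at most one common neighbour.  If there is no
      -- triangle, delete an edge together with any third vertex.
      zykov : ∀ n xs → length xs ≡ n →
              pairSum edge xs ≤ turánEdges n × tripleSum triangle xs ≤ turánTriangles n
      zykov 0 []              _ = z≤n , z≤n
      zykov 1 (_ ∷ [])        _ = z≤n , z≤n
      zykov 2 (x ∷ y ∷ [])    _ =
        ≤-trans (≤-reflexive (drop-zeros (edge x y))) (indicator≤1 (adj x y)) , z≤n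
        where
        drop-zeros : ∀ m → m + 0 + 0 ≡ m
        drop-zeros = solve-∀
      zykov (suc (suc (suc n))) xs len with tripleSum-∃ triangle xs
      ... | inj₂ (a , b , c , ys , xs↭ , abc)
        with 0<triangle {a} {b} {c} abc
           | suc-injective (suc-injective (suc-injective (≡.trans (sym (↭-length xs↭)) len)))
      ...   | ab , ac , bc | refl with zykov n ys refl
      ...     | edges , triangles =
        ≤-trans (≤-reflexive (pairSum-↭ edge edge-sym xs↭))
          (edges-bound a b c ys refl edges (≤-trans
            (singleSum-mono (edges-to-triangle ab ac bc) ys) (≤-reflexive (singleSum-const 2 ys)))) ,
        ≤-trans (≤-reflexive (≡.trans (tripleSum-↭ triangle triangle-sym₁ triangle-sym₂ xs↭)
                                      (tripleSum-split triangle a b c ys)))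
          (+-mono-≤ (+-mono-≤ (+-mono-≤ (indicator≤1 (adj a b ∧ adj a c ∧ adj b c))
            (≤-trans (singleSum-mono (triangles-on-two ab ac bc) ys)
              (≤-reflexive (≡.trans (singleSum-const 1 ys) (*-identityʳ n)))))
            (≤-trans (pairSum-mono (triangles-on-one ab ac bc) ys) edges)) triangles)
      zykov (suc (suc (suc n))) xs len | inj₁ none with pairSum-∃ edge xs
      ... | inj₁ empty = ≤-trans (≤-reflexive empty) z≤n , ≤-trans (≤-reflexive none) z≤n
      ... | inj₂ (a , b , [] , xs↭ , ab) with () ← ≡.trans (sym (↭-length xs↭)) len
      ... | inj₂ (a , b , c ∷ ys , xs↭ , ab>0)
        with suc-injective (suc-injective (suc-injective (≡.trans (sym (↭-length xs↭)) len)))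
           | 0<indicator ab>0
      ...   | refl | ab =
        ≤-trans (≤-reflexive (pairSum-↭ edge edge-sym xs↭))
          (edges-bound a b c ys refl (proj₁ (zykov n ys refl)) outer) ,
        ≤-trans (≤-reflexive none) z≤n
        where
        total≡0 : tripleSum triangle (a ∷ b ∷ c ∷ ys) ≡ 0
        total≡0 = ≡.trans (sym (tripleSum-↭ triangle triangle-sym₁ triangle-sym₂ xs↭)) none

        no-triangle-on-ab : singleSum (triangle a b) ys ≡ 0
        no-triangle-on-ab = m+n≡0⇒n≡0 (triangle a b c) (m+n≡0⇒m≡0 _ (m+n≡0⇒m≡0 _ total≡0))

        -- The arbitrary vertex c receives at most one edge from z. Three edges from z to a, b, c
        -- would include both az and bz, making abz a triangle; the sum of these extra terms
        -- vanishes here.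
        two-or-on-ab : ∀ z → edge a z + edge b z + edge c z ≤ 2 + triangle a b z
        two-or-on-ab z rewrite ab = two-plus (adj a z) (adj b z) (adj c z)

        outer : singleSum (λ z → edge a z + edge b z + edge c z) ys ≤ n * 2
        outer = begin
          singleSum (λ z → edge a z + edge b z + edge c z) ys
            ≤⟨ singleSum-mono two-or-on-ab ys ⟩
          singleSum (λ z → 2 + triangle a b z) ys
            ≡⟨ singleSum-+ (λ _ → 2) (triangle a b) ys ⟩
          singleSum (λ _ → 2) ys + singleSum (triangle a b) ys
            ≡⟨ cong₂ _+_ (singleSum-const 2 ys) no-triangle-on-ab ⟩
          n * 2 + 0
            ≡⟨ +-identityʳ (n * 2) ⟩
          n * 2 ∎
          where open ≤-Reasoning

  -- Closed forms in the class sizes of a balanced tripartition.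

  private
    [3+n]/3 : ∀ n → (3 + n) / 3 ≡ 1 + n / 3
    [3+n]/3 n = +-distrib-/-∣ˡ n {3} ∣-refl

  -- The three floors are the class sizes. The bracketing is that of the vertex type
  -- `Fin (x + (y + z))` used for the construction.
  thirds-sum : ∀ n → n / 3 + ((n + 1) / 3 + (n + 2) / 3) ≡ n
  thirds-sum 0 = refl
  thirds-sum 1 = refl
  thirds-sum 2 = refl
  thirds-sum (suc (suc (suc n)))
    rewrite [3+n]/3 n | [3+n]/3 (n + 1) | [3+n]/3 (n + 2) =
    ≡.trans (rearrange (n / 3) ((n + 1) / 3) ((n + 2) / 3)) (cong (λ m → 3 + m) (thirds-sum n))
    where
    rearrange : ∀ x y z → (1 + x) + ((1 + y) + (1 + z)) ≡ 3 + (x + (y + z))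
    rearrange = solve-∀

  turánEdges-thirds : ∀ n → turánEdges n ≡
    n / 3 * ((n + 1) / 3) + n / 3 * ((n + 2) / 3) + (n + 1) / 3 * ((n + 2) / 3)
  turánEdges-thirds 0 = refl
  turánEdges-thirds 1 = refl
  turánEdges-thirds 2 = refl
  turánEdges-thirds (suc (suc (suc n)))
    rewrite [3+n]/3 n | [3+n]/3 (n + 1) | [3+n]/3 (n + 2) | turánEdges-thirds n =
    -- Only the free-standing n is replaced by the sum of its thirds; what remains is a polynomial
    -- identity in the three class sizes.
    ≡.trans (cong (λ m → 3 + m * 2 + (n / 3 * ((n + 1) / 3) + n / 3 * ((n + 2) / 3)
                                        + (n + 1) / 3 * ((n + 2) / 3)))
              (sym (thirds-sum n)))
      (expand (n / 3) ((n + 1) / 3) ((n + 2) / 3))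
    where
    expand : ∀ x y z → 3 + (x + (y + z)) * 2 + (x * y + x * z + y * z) ≡
      (1 + x) * (1 + y) + (1 + x) * (1 + z) + (1 + y) * (1 + z)
    expand = solve-∀

  turánTriangles-thirds : ∀ n → turánTriangles n ≡ n / 3 * ((n + 1) / 3) * ((n + 2) / 3)
  turánTriangles-thirds 0 = refl
  turánTriangles-thirds 1 = refl
  turánTriangles-thirds 2 = refl
  turánTriangles-thirds (suc (suc (suc n)))
    rewrite [3+n]/3 n | [3+n]/3 (n + 1) | [3+n]/3 (n + 2)
          | turánEdges-thirds n | turánTriangles-thirds n =
    ≡.trans (cong (λ m → 1 + m + (n / 3 * ((n + 1) / 3) + n / 3 * ((n + 2) / 3)
                                    + (n + 1) / 3 * ((n + 2) / 3))
                           + n / 3 * ((n + 1) / 3) * ((n + 2) / 3)) (sym (thirds-sum n)))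
      (expand (n / 3) ((n + 1) / 3) ((n + 2) / 3))
    where
    expand : ∀ x y z → 1 + (x + (y + z)) + (x * y + x * z + y * z) + x * y * z ≡
      (1 + x) * (1 + y) * (1 + z)
    expand = solve-∀

  -- Comparing lengths of lists without repetition.

  module _ {A : Set} where

    lookup-injective : ∀ {xs : List A} → Unique xs → ∀ i j → lookup xs i ≡ lookup xs j → i ≡ j
    lookup-injective (_    ∷ _) zero    zero    _  = refl
    lookup-injective (x∉xs ∷ _) zero    (suc j) eq = contradiction eq (All.lookup x∉xs (∈-lookup j))
    lookup-injective (x∉xs ∷ _) (suc i) zero    eq =
      contradiction (sym eq) (All.lookup x∉xs (∈-lookup i))
    lookup-injective (_ ∷ uniq) (suc i) (suc j) eq = cong suc (lookup-injective uniq i j eq)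

    -- Passing to positions in `xs` turns this into the pigeonhole principle for finite ordinals,
    -- without deciding equality in `A`.
    injection⇒≤length : ∀ {k} (f : Fin k → A) → (∀ i j → f i ≡ f j → i ≡ j) →
                        (xs : List A) → (∀ i → f i ∈ xs) → k ≤ length xs
    injection⇒≤length f f-inj xs f∈ = Fin.injective⇒≤ {f = λ i → index (f∈ i)} λ {i} {j} eq →
      f-inj i j (≡.trans (lookup-index (f∈ i))
        (≡.trans (cong (lookup xs) eq) (sym (lookup-index (f∈ j)))))

    unique⇒length≤ : ∀ {xs ys : List A} → Unique xs → (∀ {x} → x ∈ xs → x ∈ ys) → length xs ≤ length ys
    unique⇒length≤ {xs} {ys} uniq xs⊆ys =
      injection⇒≤length (lookup xs) (lookup-injective uniq) ys (λ i → xs⊆ys (∈-lookup i))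

  -- Explicit lists realising the weighted sums.

  module WeightedList {V S : Set} where

    -- Each label is repeated as often as its weight, so the length is the weighted sum by
    -- construction. A list without repetition whose entries all occur here is then no longer than
    -- that sum.
    singles : (V → ℕ) → (V → S) → List V → List S
    singles f s []       = []
    singles f s (x ∷ xs) = replicate (f x) (s x) ++ singles f s xs

    pairs : (V → V → ℕ) → (V → V → S) → List V → List S
    pairs g s []       = []
    pairs g s (x ∷ xs) = singles (g x) (s x) xs ++ pairs g s xs

    triples : (V → V → V → ℕ) → (V → V → V → S) → List V → List S
    triples h s []       = []
    triples h s (x ∷ xs) = pairs (h x) (s x) xs ++ triples h s xs

    length-singles : ∀ f s xs → length (singles f s xs) ≡ singleSum f xs
    length-singles f s []       = refl
    length-singles f s (x ∷ xs) = ≡.trans (List.length-++ (replicate (f x) (s x)))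
      (cong₂ _+_ (List.length-replicate (f x)) (length-singles f s xs))

    length-pairs : ∀ g s xs → length (pairs g s xs) ≡ pairSum g xs
    length-pairs g s []       = refl
    length-pairs g s (x ∷ xs) = ≡.trans (List.length-++ (singles (g x) (s x) xs))
      (cong₂ _+_ (length-singles (g x) (s x) xs) (length-pairs g s xs))

    length-triples : ∀ h s xs → length (triples h s xs) ≡ tripleSum h xs
    length-triples h s []       = refl
    length-triples h s (x ∷ xs) = ≡.trans (List.length-++ (pairs (h x) (s x) xs))
      (cong₂ _+_ (length-pairs (h x) (s x) xs) (length-triples h s xs))

    ∈-replicate : ∀ {m} {x : S} → 0 < m → x ∈ replicate m x
    ∈-replicate {suc m} _ = here refl

    ∈-singles : ∀ {f s xs x} → x ∈ xs → 0 < f x → s x ∈ singles f s xs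
    ∈-singles (here refl) p = ∈-++⁺ˡ (∈-replicate p)
    ∈-singles {f} {s} {y ∷ _} (there i) p = ∈-++⁺ʳ (replicate (f y) (s y)) (∈-singles i p)

    ∈-pairs : ∀ {g s xs x y} → (∀ x y → g x y ≡ g y x) → (∀ x y → s x y ≡ s y x) →
              x ∈ xs → y ∈ xs → x ≢ y → 0 < g x y → s x y ∈ pairs g s xs
    ∈-pairs g-sym s-sym (here refl) (here refl) x≢y _ = contradiction refl x≢y
    ∈-pairs g-sym s-sym (here refl) (there j) _ p = ∈-++⁺ˡ (∈-singles j p)
    ∈-pairs {g} {s} {y ∷ ys} {x} g-sym s-sym (there i) (here refl) _ p =
      subst (_∈ pairs g s (y ∷ ys)) (s-sym y x)
        (∈-++⁺ˡ (∈-singles {f = g y} {s = s y} i (subst (0 <_) (g-sym x y) p)))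
    ∈-pairs {g} {s} {z ∷ zs} g-sym s-sym (there i) (there j) x≢y p =
      ∈-++⁺ʳ (singles (g z) (s z) zs) (∈-pairs g-sym s-sym i j x≢y p)

    -- Triples are enumerated only in list order, while a triangle arrives in any labelling;
    -- symmetry of weights and labels brings whichever vertex is met at the head to the first place.
    ∈-triples : ∀ {h : V → V → V → ℕ} {s : V → V → V → S} {xs x y z} →
      (∀ x y z → h x y z ≡ h y x z) → (∀ x y z → h x y z ≡ h x z y) →
      (∀ x y z → s x y z ≡ s y x z) → (∀ x y z → s x y z ≡ s x z y) →
      x ∈ xs → y ∈ xs → z ∈ xs → x ≢ y → x ≢ z → y ≢ z → 0 < h x y z → s x y z ∈ triples h s xs
    ∈-triples {h} {s} h₁ h₂ s₁ s₂ = go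
      where
      tail : ∀ {x y : V} {ys} → y ∈ x ∷ ys → x ≢ y → y ∈ ys
      tail (here refl) x≢y = contradiction refl x≢y
      tail (there i)   _   = i

      go : ∀ {xs x y z} → x ∈ xs → y ∈ xs → z ∈ xs → x ≢ y → x ≢ z → y ≢ z →
           0 < h x y z → s x y z ∈ triples h s xs
      go {x = x} {y} {z} (here refl) j k xy xz yz p =
        ∈-++⁺ˡ (∈-pairs {g = h x} {s = s x} (h₂ x) (s₂ x) (tail j xy) (tail k xz) yz p)
      go {y ∷ ys} {x} {z = z} (there i) (here refl) k xy xz yz p =
        subst (_∈ triples h s (y ∷ ys)) (s₁ y x z)
          (∈-++⁺ˡ (∈-pairs {g = h y} {s = s y} (h₂ y) (s₂ y) i (tail k yz) xz
            (subst (0 <_) (h₁ x y z) p)))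
      go {z ∷ zs} {x} {y} (there i) (there j) (here refl) xy xz yz p =
        subst (_∈ triples h s (z ∷ zs)) (≡.trans (s₁ z x y) (s₂ x z y))
          (∈-++⁺ˡ (∈-pairs {g = h z} {s = s z} (h₂ z) (s₂ z) i j xy
            (subst (0 <_) (≡.trans (h₂ x y z) (h₁ x z y)) p)))
      go {w ∷ ws} (there i) (there j) (there k) xy xz yz p =
        ∈-++⁺ʳ (pairs (h w) (s w) ws) (go i j k xy xz yz p)

open Counting
open import Data.Nat.Base using (_+_; _*_; _/_; NonZero)

-- Subsets of a finite index set.

allSubsets : ∀ n → List (Subset n)
allSubsets zero    = [ [] ]
allSubsets (suc n) = map (inside ∷_) (allSubsets n) ++ map (outside ∷_) (allSubsets n)

∈-allSubsets : ∀ {n} (S : Subset n) → S ∈ allSubsets n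
∈-allSubsets []            = here ≡.refl
∈-allSubsets (inside ∷ S)  = ∈-++⁺ˡ (∈-map⁺ (inside ∷_) (∈-allSubsets S))
∈-allSubsets (outside ∷ S) =
  ∈-++⁺ʳ (map (inside ∷_) (allSubsets _)) (∈-map⁺ (outside ∷_) (∈-allSubsets S))

allSubsets-unique : ∀ n → Unique (allSubsets n)
allSubsets-unique zero    = [] ∷ []
allSubsets-unique (suc n) = Unique.++⁺
  (Unique.map⁺ ∷-injectiveʳ (allSubsets-unique n))
  (Unique.map⁺ ∷-injectiveʳ (allSubsets-unique n))
  λ (p , q) → disjoint (∈-map⁻ (inside ∷_) p) (∈-map⁻ (outside ∷_) q)
  where
  disjoint : ∀ {S : Subset (suc n)} {P Q : Pred (Subset n) 0ℓ} →
    (∃ λ R → P R × S ≡ inside ∷ R) → (∃ λ R → Q R × S ≡ outside ∷ R) → ⊥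
  disjoint (_ , _ , eq) (_ , _ , eq′) with () ← ∷-injectiveˡ (≡.trans (≡.sym eq) eq′)

-- Excluded middle decides the predicate, so filtering the finite list of all subsets gives an
-- actual count.
hasCard : ExcludedMiddle 0ℓ → ∀ {n} (Q : Pred (Subset n) 0ℓ) → ∃ (HasCard Q)
hasCard em {n} Q = _ , filter Q? (allSubsets n) , Unique.filter⁺ Q? (allSubsets-unique n) , ≡.refl ,
  λ S → mk⇔ (proj₂ ∘ ∈-filter⁻ Q? {xs = allSubsets n}) (∈-filter⁺ Q? (∈-allSubsets S))
  where
  Q? : ∀ S → Dec (Q S)
  Q? S = em

triple : ∀ {n} → Fin n → Fin n → Fin n → Subset n
triple i j k = ⁅ i ⁆ ∪ ⁅ j ⁆ ∪ ⁅ k ⁆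

triple-sym₁ : ∀ {n} (i j k : Fin n) → triple i j k ≡ triple j i k
triple-sym₁ i j k = ≡.trans (≡.sym (∪-assoc ⁅ i ⁆ ⁅ j ⁆ ⁅ k ⁆))
  (≡.trans (≡.cong (_∪ ⁅ k ⁆) (∪-comm ⁅ i ⁆ ⁅ j ⁆)) (∪-assoc ⁅ j ⁆ ⁅ i ⁆ ⁅ k ⁆))

triple-sym₂ : ∀ {n} (i j k : Fin n) → triple i j k ≡ triple i k j
triple-sym₂ i j k = ≡.cong (⁅ i ⁆ ∪_) (∪-comm ⁅ j ⁆ ⁅ k ⁆)

∈-triple⁻ : ∀ {n} {x i j k : Fin n} → x ∈ₛ triple i j k → x ≡ i ⊎ x ≡ j ⊎ x ≡ k
∈-triple⁻ {i = i} {j} {k} x∈ with x∈p∪q⁻ ⁅ i ⁆ _ x∈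
... | inj₁ x∈i = inj₁ (x∈⁅y⁆⇒x≡y i x∈i)
... | inj₂ x∈jk with x∈p∪q⁻ ⁅ j ⁆ ⁅ k ⁆ x∈jk
...   | inj₁ x∈j = inj₂ (inj₁ (x∈⁅y⁆⇒x≡y j x∈j))
...   | inj₂ x∈k = inj₂ (inj₂ (x∈⁅y⁆⇒x≡y k x∈k))

∣⁅i⁆∪p∣ : ∀ {n} (i : Fin n) p → i ∉ p → ∣ ⁅ i ⁆ ∪ p ∣ ≡ suc ∣ p ∣
∣⁅i⁆∪p∣ zero    (inside ∷ p)  i∉p = contradiction Vec.here i∉p
∣⁅i⁆∪p∣ zero    (outside ∷ p) _   = ≡.cong (suc ∘ ∣_∣) (∪-identityˡ p)
∣⁅i⁆∪p∣ (suc i) (inside ∷ p)  i∉p = ≡.cong suc (∣⁅i⁆∪p∣ i p (i∉p ∘ Vec.there))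
∣⁅i⁆∪p∣ (suc i) (outside ∷ p) i∉p = ∣⁅i⁆∪p∣ i p (i∉p ∘ Vec.there)

∣triple∣≡3 : ∀ {n} {i j k : Fin n} → i ≢ j → i ≢ k → j ≢ k → ∣ triple i j k ∣ ≡ 3
∣triple∣≡3 {i = i} {j} {k} i≢j i≢k j≢k = ≡.trans
  (∣⁅i⁆∪p∣ i (⁅ j ⁆ ∪ ⁅ k ⁆) ([ x≢y⇒x∉⁅y⁆ i≢j , x≢y⇒x∉⁅y⁆ i≢k ]′ ∘ x∈p∪q⁻ ⁅ j ⁆ ⁅ k ⁆))
  (≡.cong suc (≡.trans (∣⁅i⁆∪p∣ j ⁅ k ⁆ (x≢y⇒x∉⁅y⁆ j≢k)) (≡.cong suc (∣⁅x⁆∣≡1 k))))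

-- Transversals of a tripartition.

module Tripartition (x y z : ℕ) where

  in₀ : Fin x → Fin (x + (y + z))
  in₀ i = i ↑ˡ (y + z)

  in₁ : Fin y → Fin (x + (y + z))
  in₁ j = x ↑ʳ (j ↑ˡ z)

  in₂ : Fin z → Fin (x + (y + z))
  in₂ k = x ↑ʳ (y ↑ʳ k)

  part : Fin (x + (y + z)) → Fin 3
  part = [ const 0F , [ const 1F , const 2F ]′ ∘ splitAt y ]′ ∘ splitAt x

  part-in₀ : ∀ i → part (in₀ i) ≡ 0F
  part-in₀ i rewrite Fin.splitAt-↑ˡ x i (y + z) = ≡.refl

  part-in₁ : ∀ j → part (in₁ j) ≡ 1F
  part-in₁ j rewrite Fin.splitAt-↑ʳ x (y + z) (j ↑ˡ z) | Fin.splitAt-↑ˡ y j z = ≡.refl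

  part-in₂ : ∀ k → part (in₂ k) ≡ 2F
  part-in₂ k rewrite Fin.splitAt-↑ʳ x (y + z) (y ↑ʳ k) | Fin.splitAt-↑ʳ y z k = ≡.refl

  transversal : Fin x → Fin y → Fin z → Subset (x + (y + z))
  transversal i j k = triple (in₀ i) (in₁ j) (in₂ k)

  private
    apart : ∀ {u v l m} → part u ≡ l → part v ≡ m → l ≢ m → u ≢ v
    apart pu pv l≢m ≡.refl = l≢m (≡.trans (≡.sym pu) pv)

  -- A transversal has one element in each class, so an element is matched with the only member of
  -- the other triple lying in its own class.
  transversal-injective : ∀ {i j k i′ j′ k′} → transversal i j k ≡ transversal i′ j′ k′ →
                          i ≡ i′ × j ≡ j′ × k ≡ k′
  transversal-injective {i} {j} {k} {i′} {j′} {k′} eq = same₀ , same₁ , same₂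
    where
    ∈′ : ∀ {v} → v ∈ₛ transversal i j k → v ≡ in₀ i′ ⊎ v ≡ in₁ j′ ⊎ v ≡ in₂ k′
    ∈′ {v} v∈ = ∈-triple⁻ (≡.subst (v ∈ₛ_) eq v∈)

    same₀ : i ≡ i′
    same₀ with ∈′ (x∈p∪q⁺ (inj₁ (x∈⁅x⁆ (in₀ i))))
    ... | inj₁ p        = Fin.↑ˡ-injective (y + z) i i′ p
    ... | inj₂ (inj₁ p) = contradiction p (apart (part-in₀ i) (part-in₁ j′) λ ())
    ... | inj₂ (inj₂ p) = contradiction p (apart (part-in₀ i) (part-in₂ k′) λ ())

    same₁ : j ≡ j′
    same₁ with ∈′ (x∈p∪q⁺ {p = ⁅ in₀ i ⁆} (inj₂ (x∈p∪q⁺ (inj₁ (x∈⁅x⁆ (in₁ j))))))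
    ... | inj₁ p        = contradiction p (apart (part-in₁ j) (part-in₀ i′) λ ())
    ... | inj₂ (inj₁ p) = Fin.↑ˡ-injective z j j′ (Fin.↑ʳ-injective x _ _ p)
    ... | inj₂ (inj₂ p) = contradiction p (apart (part-in₁ j) (part-in₂ k′) λ ())

    same₂ : k ≡ k′
    same₂ with ∈′ (x∈p∪q⁺ {p = ⁅ in₀ i ⁆} (inj₂ (x∈p∪q⁺ {p = ⁅ in₁ j ⁆} (inj₂ (x∈⁅x⁆ (in₂ k))))))
    ... | inj₁ p        = contradiction p (apart (part-in₂ k) (part-in₀ i′) λ ())
    ... | inj₂ (inj₁ p) = contradiction p (apart (part-in₂ k) (part-in₁ j′) λ ())
    ... | inj₂ (inj₂ p) = Fin.↑ʳ-injective y k k′ (Fin.↑ʳ-injective x _ _ p)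

  transversals : Fin (x * y * z) → Subset (x + (y + z))
  transversals t =
    let ij , k = remQuot {x * y} z t
        i  , j = remQuot {x} y ij
    in transversal i j k

  transversals-injective : ∀ t u → transversals t ≡ transversals u → t ≡ u
  transversals-injective t u eq with transversal-injective eq
  ... | i≡ , j≡ , k≡ = ≡.trans (≡.sym (Fin.combine-remQuot {x * y} z t))
    (≡.trans (≡.cong₂ combine ij≡ k≡) (Fin.combine-remQuot {x * y} z u))
    where
    ij≡ : proj₁ (remQuot {x * y} z t) ≡ proj₁ (remQuot {x * y} z u)
    ij≡ = ≡.trans (≡.sym (Fin.combine-remQuot {x} y _))
      (≡.trans (≡.cong₂ combine i≡ j≡) (Fin.combine-remQuot {x} y _))

  transversals≤card : ∀ {Q : Pred (Subset (x + (y + z))) 0ℓ} {c} →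
    (∀ i j k → Q (transversal i j k)) → HasCard Q c → x * y * z ℕ.≤ c
  transversals≤card q (xs , _ , ≡.refl , xs⇔Q) =
    injection⇒≤length transversals transversals-injective xs
      (λ t → Equivalence.from (xs⇔Q (transversals t)) (q _ _ _))

-- Distinct offsets for the points of a cluster.

module Halving (em : ExcludedMiddle 0ℓ) (ℝ : RealField) where
  open RealField ℝ hiding (zero) renaming (_*_ to _·_; _+_ to _⊕_)
  open OrderedField em ℝ

  ½ : Carrier
  ½ = proj₁ (reciprocal 1)

  ½-positive : Positive ½
  ½-positive = proj₁ (proj₂ (reciprocal 1))

  2·½x≈x : ∀ x → # 2 · (½ · x) ≈ x
  2·½x≈x x = trans (sym (*-assoc _ _ _)) (trans (*-congʳ (proj₂ (proj₂ (reciprocal 1)))) (*-identityˡ x))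

  -- A source of arbitrarily many different positive numbers, all at most r.
  halve : Carrier → ℕ → Carrier
  halve r zero    = r
  halve r (suc i) = ½ · halve r i

  halve-positive : ∀ {r} → Positive r → ∀ i → Positive (halve r i)
  halve-positive r>0 zero    = r>0
  halve-positive r>0 (suc i) = *-positive ½-positive (halve-positive r>0 i)

  halve-≤ : ∀ {r} → Positive r → ∀ i → halve r i ≤ r
  halve-≤ r>0 zero = ≤-refl
  halve-≤ {r} r>0 (suc i) = ≤-trans (0≤y-x⇒x≤y (≤-respʳ (positive⇒nonNeg (halve-positive r>0 (suc i)))
    (trans (solve 1 (λ h → h := con (+ 2) :* h :- h) refl (½ · halve r i))
      (+-congʳ (2·½x≈x (halve r i)))))) (halve-≤ r>0 i)

  -- Doubling the supposed equality gives 2r ≈ `halve r i` ≤ r, impossible for positive r.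
  halve-zero≉suc : ∀ {r} → Positive r → ∀ i → ¬ (r ≈ halve r (suc i))
  halve-zero≉suc {r} r>0 i eq = r>0 (0≤y-x⇒x≤y (≤-respʳ (x≤y⇒0≤y-x 2r≤r)
    (solve 1 (λ r → r :- con (+ 2) :* r := con (+ 0) :- r) refl r)))
    where
    2r≤r : # 2 · r ≤ r
    2r≤r = ≤-respˡ (trans (*-congˡ eq) (2·½x≈x (halve r i))) (halve-≤ r>0 i)

  halve-injective : ∀ {r} → Positive r → ∀ i j → halve r i ≈ halve r j → i ≡ j
  halve-injective r>0 zero    zero    _  = ≡.refl
  halve-injective r>0 zero    (suc j) eq = contradiction eq (halve-zero≉suc r>0 j)
  halve-injective r>0 (suc i) zero    eq = contradiction (sym eq) (halve-zero≉suc r>0 i)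
  halve-injective {r} r>0 (suc i) (suc j) eq = ≡.cong suc (halve-injective r>0 i j
    (trans (sym (2·½x≈x (halve r i))) (trans (*-congˡ eq) (2·½x≈x (halve r j)))))

-- The upper bound at tolerance 1/50.

module Equilateral (em : ExcludedMiddle 0ℓ) (ℝ : RealField) (T : Plane.Triangle ℝ)
                   (equilateral : Plane.IsEquilateral ℝ T) where
  open RealField ℝ hiding (zero) renaming (_*_ to _·_; _+_ to _⊕_)
  open Plane ℝ
  open OrderedField em ℝ
  open NearUnitGraph em ℝ
  open Halving em ℝ
  open Triangle T
  private module M = Min totalOrder

  IsDist-resp : ∀ {P Q d e} → d ≈ e → IsDist P Q d → IsDist P Q e
  IsDist-resp d≈e (0≤d , dd≈) = ≤-respʳ 0≤d d≈e , trans (*-cong (sym d≈e) (sym d≈e)) dd≈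

  IsDist-sym : ∀ {P Q d} → IsDist P Q d → IsDist Q P d
  IsDist-sym {P} {Q} (0≤d , dd≈) = 0≤d , trans dd≈ (dist²-sym P Q)

  b≈a : b ≈ a
  b≈a = sym (proj₁ equilateral)

  c≈a : c ≈ a
  c≈a = trans (sym (proj₂ equilateral)) b≈a

  -- A zero side would be the common length, so A and B would coincide and the vertices would be
  -- collinear.
  a-positive : Positive a
  a-positive = ≉0⇒positive (proj₁ |BC|≡a) λ a≈0 → nonCollinear (collinear (trans c≈a a≈0))
    where
    collinear : c ≈ 0# → Collinear A B C
    collinear c≈0 = trans (trans (*-congʳ Δx≈0) (zeroˡ _)) (sym (trans (*-congʳ Δy≈0) (zeroˡ _)))
      where
      x₁ = proj₁ A ; y₁ = proj₂ A ; x₂ = proj₁ B ; y₂ = proj₂ B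
      sum≤0 : (x₂ - x₁) · (x₂ - x₁) ⊕ (y₂ - y₁) · (y₂ - y₁) ≤ 0#
      sum≤0 = ≤-reflexive (trans (sym (proj₂ (IsDist-sym {A} {B} |AB|≡c)))
        (trans (*-congʳ c≈0) (zeroˡ c)))

      Δx≈0 : x₂ - x₁ ≈ 0#
      Δx≈0 = sq≤0⇒≈0 (≤-trans (0≤y-x⇒x≤y (≤-respʳ (sq-nonNeg (y₂ - y₁))
        (solve 2 (λ u v → v := u :+ v :- u) refl _ _))) sum≤0)

      Δy≈0 : y₂ - y₁ ≈ 0#
      Δy≈0 = sq≤0⇒≈0 (≤-trans (0≤y-x⇒x≤y (≤-respʳ (sq-nonNeg (x₂ - x₁))
        (solve 2 (λ u v → u := u :+ v :- v) refl _ _))) sum≤0)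

  σ : Carrier
  σ = a · a

  σ-positive : Positive σ
  σ-positive = *-positive a-positive a-positive

  μ : Carrier
  μ = a ⊓ b ⊓ c

  μ≤a : μ ≤ a
  μ≤a = ≤-trans (M.x⊓y≤x (a ⊓ b) c) (M.x⊓y≤x a b)

  μ-positive : Positive μ
  μ-positive = ⊓-positive (⊓-positive a-positive (positive-≈ a-positive (sym b≈a)))
    (positive-≈ a-positive (sym c≈a))
    where
    ⊓-positive : ∀ {x y} → Positive x → Positive y → Positive (x ⊓ y)
    ⊓-positive {x} {y} x>0 y>0 with M.⊓-sel x y
    ... | inj₁ eq = positive-≈ x>0 (sym eq)
    ... | inj₂ eq = positive-≈ y>0 (sym eq)

  ε₀ : Carrier
  ε₀ = proj₁ (reciprocal 49)

  ε₀-positive : Positive ε₀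
  ε₀-positive = proj₁ (proj₂ (reciprocal 49))

  50ε₀μ≤a : # 50 · (ε₀ · μ) ≤ a
  50ε₀μ≤a = ≤-respˡ (trans (sym (*-assoc _ _ _))
    (trans (*-congʳ (proj₂ (proj₂ (reciprocal 49)))) (*-identityˡ μ))) μ≤a

  module UpperBound {n} (P : PointSet n) where
    p = proj₁ P

    adj : Fin n → Fin n → Bool
    adj i j = does (em {P = Adj σ (p i) (p j)})

    adj⇒Adj : ∀ {i j} → adj i j ≡ true → Adj σ (p i) (p j)
    adj⇒Adj {i} {j} eq with em {P = Adj σ (p i) (p j)}
    ... | yes ij = ij

    Adj⇒adj : ∀ {i j} → Adj σ (p i) (p j) → adj i j ≡ true
    Adj⇒adj = dec-true em

    adj-sym : ∀ i j → adj i j ≡ adj j i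
    adj-sym i j = does-⇔ (mk⇔ (Adj-sym (p i) (p j)) (Adj-sym (p j) (p i))) em em

    Adj⇒≢ : ∀ {i j} → Adj σ (p i) (p j) → i ≢ j
    Adj⇒≢ ij ≡.refl = Adj⇒≉ σ-positive ij (refl , refl)

    open CliqueCount adj adj-sym
    open WeightedList {Fin n} {Subset n}

    K₄-free : ∀ {w x y z} → adj w x ≡ true → adj w y ≡ true → adj w z ≡ true →
              adj x y ≡ true → adj x z ≡ true → adj y z ≡ true → ⊥
    K₄-free {w} {x} {y} {z} wx wy wz xy xz yz =
      Adj-K₄-free (p w) (p x) (p y) (p z) σ-positive (adj⇒Adj wx) (adj⇒Adj wy) (adj⇒Adj wz)
        (adj⇒Adj xy) (adj⇒Adj xz) (adj⇒Adj yz)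

    -- ε₀-congruence is used only through the pairwise adjacencies it forces, which also make the
    -- three indices distinct.
    forms⇒∈ : ∀ {S} → FormsTriangle T ε₀ P S → S ∈ triples triangle triple (allFin n)
    forms⇒∈ (_ , i , j , k , ≡.refl , ε₀-congruent) =
      ∈-triples triangle-sym₁ triangle-sym₂ triple-sym₁ triple-sym₂
        (∈-allFin i) (∈-allFin j) (∈-allFin k) (Adj⇒≢ ij) (Adj⇒≢ ik) (Adj⇒≢ jk)
        (triangle>0 {i} {j} {k} (Adj⇒adj ij) (Adj⇒adj ik) (Adj⇒adj jk))
      where
      open EpsCongruent ε₀-congruent renaming (A to A₀; B to B₀; C to C₀)
      B₀C₀ = proj₁ congruent
      C₀A₀ = proj₁ (proj₂ congruent)
      A₀B₀ = proj₂ (proj₂ congruent)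

      ij : Adj σ (p i) (p j)
      ij = close⇒Adj 50ε₀μ≤a (IsDist-resp {A₀} {B₀} c≈a A₀B₀) A-close B-close
      ik : Adj σ (p i) (p k)
      ik = Adj-sym (p k) (p i) (close⇒Adj 50ε₀μ≤a (IsDist-resp {C₀} {A₀} b≈a C₀A₀) C-close A-close)
      jk : Adj σ (p j) (p k)
      jk = close⇒Adj 50ε₀μ≤a B₀C₀ B-close C-close

    card≤ : ∀ {k} → HasCard (FormsTriangle T ε₀ P) k → k ℕ.≤ n / 3 * ((n + 1) / 3) * ((n + 2) / 3)
    card≤ (xs , unique , ≡.refl , xs⇔) = begin
      length xs
        ≤⟨ unique⇒length≤ unique (λ {S} S∈ → forms⇒∈ (Equivalence.to (xs⇔ S) S∈)) ⟩
      length (triples triangle triple (allFin n))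
        ≡⟨ length-triples triangle triple (allFin n) ⟩
      tripleSum triangle (allFin n)
        ≤⟨ proj₂ (zykov K₄-free n (allFin n) (List.length-tabulate (λ i → i))) ⟩
      turánTriangles n
        ≡⟨ turánTriangles-thirds n ⟩
      n / 3 * ((n + 1) / 3) * ((n + 2) / 3)
        ∎
      where open ℕ.≤-Reasoning

  -- The construction with three clusters.

  vertex : Fin 3 → Point
  vertex 0F = A
  vertex 1F = B
  vertex 2F = C

  vertex-dist : ∀ l m → l ≢ m → IsDist (vertex l) (vertex m) a
  vertex-dist 0F 0F l≢m = contradiction ≡.refl l≢m
  vertex-dist 0F 1F _   = IsDist-resp {A} {B} c≈a |AB|≡c
  vertex-dist 0F 2F _   = IsDist-sym {C} {A} (IsDist-resp {C} {A} b≈a |CA|≡b)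
  vertex-dist 1F 0F _   = IsDist-sym {A} {B} (IsDist-resp {A} {B} c≈a |AB|≡c)
  vertex-dist 1F 1F l≢m = contradiction ≡.refl l≢m
  vertex-dist 1F 2F _   = |BC|≡a
  vertex-dist 2F 0F _   = IsDist-resp {C} {A} b≈a |CA|≡b
  vertex-dist 2F 1F _   = IsDist-sym {B} {C} |BC|≡a
  vertex-dist 2F 2F l≢m = contradiction ≡.refl l≢m

  module Clusters {r} (r>0 : Positive r) (50r≤a : # 50 · r ≤ a) {n} (part : Fin n → Fin 3) where

    p : Fin n → Point
    -- The offset depends on the index in the whole set, so it differs for any two points of a
    -- cluster; as a horizontal shift, it is also the distance to the vertex.
    p i = let x , y = vertex (part i) in x ⊕ halve r (toℕ i) , y

    p-close : ∀ {ρ} → r ≤ ρ → ∀ i → InClosedDisk (vertex (part i)) ρ (p i)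
    p-close r≤ρ i = halve r (toℕ i) ,
      (positive⇒nonNeg (halve-positive r>0 (toℕ i)) ,
       solve 3 (λ x y t → t :* t := (x :- (x :+ t)) :* (x :- (x :+ t)) :+ (y :- y) :* (y :- y))
         refl _ _ _) ,
      ≤-trans (halve-≤ r>0 (toℕ i)) r≤ρ

    p-Adj : ∀ i j → part i ≢ part j → Adj σ (p i) (p j)
    p-Adj i j i≢j =
      close⇒Adj 50r≤a (vertex-dist (part i) (part j) i≢j) (p-close ≤-refl i) (p-close ≤-refl j)

    -- Points of different clusters are adjacent, hence apart; within one cluster the offsets
    -- differ.
    p-injective : ∀ {i j} → p i ≈ₚ p j → i ≡ j
    p-injective {i} {j} pi≈pj with part i Fin.≟ part j
    ... | no i≢j = contradiction pi≈pj (Adj⇒≉ σ-positive (p-Adj i j i≢j))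
    ... | yes i≡j = Fin.toℕ-injective (halve-injective r>0 (toℕ i) (toℕ j)
      (cancel (trans (proj₁ pi≈pj)
        (reflexive (≡.cong (λ l → proj₁ (vertex l) ⊕ halve r (toℕ j)) (≡.sym i≡j))))))
      where
      cancel : ∀ {x t u} → x ⊕ t ≈ x ⊕ u → t ≈ u
      cancel {x} {t} {u} eq = trans (solve 2 (λ x t → t := x :+ t :- x) refl x t)
        (trans (+-congʳ eq) (solve 2 (λ x u → x :+ u :- x := u) refl x u))

    points : PointSet n
    points = p , p-injective

    forms : ∀ {ε} → r ≤ tolerance T ε → ∀ i j k →
            part i ≡ 0F → part j ≡ 1F → part k ≡ 2F → FormsTriangle T ε points (triple i j k)
    forms r≤ε i j k i₀ j₁ k₂ =
      ∣triple∣≡3 (i≢j ∘ ≡.cong part) (i≢k ∘ ≡.cong part) (j≢k ∘ ≡.cong part) ,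
      i , j , k , ≡.refl , record
        { isTriangle = Adj⇒nonCollinear (p i) (p j) (p k) σ-positive
                         (p-Adj i j i≢j) (p-Adj i k i≢k) (p-Adj j k j≢k)
        ; A = A ; B = B ; C = C
        ; congruent = |BC|≡a , |CA|≡b , |AB|≡c
        ; A-close = close i i₀ ; B-close = close j j₁ ; C-close = close k k₂
        }
      where
      differ : ∀ {i j l m} → part i ≡ l → part j ≡ m → l ≢ m → part i ≢ part j
      differ pi pj l≢m eq = l≢m (≡.trans (≡.sym pi) (≡.trans eq pj))
      i≢j = differ i₀ j₁ λ ()
      i≢k = differ i₀ k₂ λ ()
      j≢k = differ j₁ k₂ λ ()
      close : ∀ i {l} → part i ≡ l → InClosedDisk (vertex l) (tolerance T _) (p i)
      close i ≡.refl = p-close r≤ε i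

  -- A large ε alone would permit clusters that overlap. Capping the radius at ε₀μ as well keeps
  -- distinct clusters adjacent for every ε.
  cluster-radius : ∀ {ε} → Positive ε → ∃ λ r → Positive r × # 50 · r ≤ a × r ≤ tolerance T ε
  cluster-radius {ε} ε>0 =
    let r , r>0 , r≤ , r≤₀ = common-lower (*-positive ε>0 μ-positive) (*-positive ε₀-positive μ-positive)
    in r , r>0 , ≤-trans (*-monoʳ-≤ (#-nonNeg 50) r≤₀) 50ε₀μ≤a , r≤

  lower-bound : ∀ {ε} → Positive ε → ∀ {n} x y z → x + (y + z) ≡ n → ∃ λ (P : PointSet n) → ∃ λ k →
                HasCard (FormsTriangle T ε P) k × x * y * z ℕ.≤ k
  lower-bound {ε} ε>0 x y z ≡.refl =
    let r , r>0 , 50r≤a , r≤ε = cluster-radius ε>0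
        open Clusters r>0 50r≤a part
        k , card = hasCard em (FormsTriangle T ε points)
    in points , k , card ,
       transversals≤card (λ i j k → forms r≤ε (in₀ i) (in₁ j) (in₂ k)
                                      (part-in₀ i) (part-in₁ j) (part-in₂ k)) card
    where open Tripartition x y z

theorem1p1 : ExcludedMiddle 0ℓ → (ℝ : RealField) → let open Plane ℝ in
    (T : Triangle) → IsEquilateral T →
    (n : ℕ) → .{{_ : NonZero n}} →
    Is-h n T ((n / 3) * ((n + 1) / 3) * ((n + 2) / 3))
theorem1p1 em ℝ T equilateral n =
  -- The minimum is attained at ε₀, the one tolerance for which the upper bound is proved.
  (ε₀ , (positive⇒nonNeg ε₀-positive , positive⇒≉0 ε₀-positive ∘ sym) , attained ,
    λ k (P , card) → UpperBound.card≤ P card) ,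
  -- For any other ε, m is the maximum by assumption, so it is at least the count for the clusters
  -- built at that ε.
  λ m (ε , (0≤ε , 0≉ε) , _ , maximal) →
    let P , k , card , ≤k = clusters (≉0⇒positive 0≤ε (0≉ε ∘ sym)) in ℕ.≤-trans ≤k (maximal k (P , card))
  where
  open RealField ℝ using (sym)
  open Plane ℝ
  open OrderedField em ℝ
  open Equilateral em ℝ T equilateral

  clusters : ∀ {ε} → Positive ε → ∃ λ (P : PointSet n) → ∃ λ k →
             HasCard (FormsTriangle T ε P) k × n / 3 * ((n + 1) / 3) * ((n + 2) / 3) ℕ.≤ k
  clusters ε>0 = lower-bound ε>0 (n / 3) ((n + 1) / 3) ((n + 2) / 3) (thirds-sum n)

  attained : ∃ λ (P : PointSet n) →
             HasCard (FormsTriangle T ε₀ P) (n / 3 * ((n + 1) / 3) * ((n + 2) / 3))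
  attained =
    let P , k , card , ≤k = clusters ε₀-positive
    -- The cluster set may a priori form further triangles; the upper bound at ε₀ makes its count
    -- exact.
    in P , ≡.subst (HasCard (FormsTriangle T ε₀ P)) (ℕ.≤-antisym (UpperBound.card≤ P card) ≤k) card
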